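{- For any hypergraph $H$ with $R(H)=\{1,2\}$, letting $H^2$ denote the graph of its $2$-edges, $$\pi(H)=\begin{cases}2-\frac{1}{\chi(H^2)-1} & \text{if } H^2 \text{ is not bipartite};\\ \frac54 & \text{if } H^2 \text{ is bipartite and } \min\{k\colon \bar P_{2k}\subseteq H\}=1;\\ \frac98 & \text{if } H^2 \text{ is bipartite and } \min\{k\colon \bar P_{2k}\subseteq H\}\ge 2;\\ 1 & \text{if } H^2 \text{ is bipartite and } \bar P_{2k}\not\subseteq H \text{ for all } k\ge1.\end{cases}$$
   Context: A hypergraph $G=(V,E)$ has a finite vertex set and edge set $E\subseteq 2^V$ (edges may have different sizes); $R(G)=\{|F|\colon F\in E\}$. For $G$ on $n$ vertices, $h_n(G)=\sum_{F\in E(G)}1/\binom{n}{|F|}$. $H_1\subseteq H_2$ if there is an injective $f\colon V(H_1)\to V(H_2)$ with $f(F)\in E(H_2)$ for all $F\in E(H_1)$. $\pi_n(H)=\max\{h_n(G)\colon v(G)=n,\ R(G)\subseteq R(H),\ H\not\subseteq G\}$, $\pi(H)=\lim_{n\to\infty}\pi_n(H)$. $\chi$ is the chromatic number. The closed path $\bar P_m$ has vertices $x_1,\dots,x_m$, $1$-edges $\{x_1\},\{x_m\}$ and $2$-edges $\{x_i,x_{i+1}\}$, $1\le i\le m-1$. -}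

module Defs where

open import Data.Nat as ℕ using (ℕ; zero; suc; _≥_)
open import Data.Nat.Combinatorics using (_C_)
open import Data.Integer using (+_)
open import Data.Rational using (ℚ; 0ℚ; _+_; _-_; _<_; _/_; ∣_∣)
open import Data.Bool using (Bool; true; false; _∨_; _∧_)
import Data.Bool as B
open import Data.Fin using (Fin; zero; suc; fromℕ; inject₁)
import Data.Fin as F
open import Data.Fin.Properties using (any?)
open import Data.Fin.Subset using (Subset; ⁅_⁆; _∪_; _∈_) renaming (∣_∣ to size)
open import Data.Fin.Subset.Properties using (_∈?_)
open import Data.Vec using ([]; _∷_; tabulate)
open import Data.Vec.Properties using (≡-dec)
open import Data.Product using (Σ; ∃; _×_; _,_)
open import Data.Sum using (_⊎_)
open import Relation.Nullary using (¬_)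
open import Relation.Nullary.Decidable using (⌊_⌋; _×-dec_)
open import Relation.Binary.PropositionalEquality using (_≡_; _≢_)
open import Function.Definitions using (Injective)
open import Function using (_∘_)

record Hypergraph : Set where
  constructor hg
  field
    v : ℕ
    E : Subset v → Bool
open Hypergraph public

IsEdge : (G : Hypergraph) → Subset (v G) → Set
IsEdge G F = E G F ≡ true

_≟S_ : ∀ {n} (A B : Subset n) → Relation.Nullary.Dec (A ≡ B)
_≟S_ = ≡-dec B._≟_

image : ∀ {m n} → (Fin m → Fin n) → Subset m → Subset n
image f A = tabulate (λ j → ⌊ any? (λ i → (i ∈? A) ×-dec (f i F.≟ j)) ⌋)

_⊆H_ : Hypergraph → Hypergraph → Set
H₁ ⊆H H₂ = Σ (Fin (v H₁) → Fin (v H₂)) λ f →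
  Injective _≡_ _≡_ f × (∀ A → IsEdge H₁ A → IsEdge H₂ (image f A))

RSub : Hypergraph → Hypergraph → Set
RSub G H = ∀ A → IsEdge G A → Σ (Subset (v H)) λ B → IsEdge H B × size A ≡ size B

R≡12 : Hypergraph → Set
R≡12 H = (∀ A → IsEdge H A → size A ≡ 1 ⊎ size A ≡ 2)
       × (∃ λ A → IsEdge H A × size A ≡ 1)
       × (∃ λ A → IsEdge H A × size A ≡ 2)

sumSubsets : (n : ℕ) → (Subset n → ℚ) → ℚ
sumSubsets zero    f = f []
sumSubsets (suc n) f = sumSubsets n (f ∘ (false ∷_)) + sumSubsets n (f ∘ (true ∷_))

-- 1 / m  (with 1/0 := 0; never used since |F| ≤ n gives n C |F| ≥ 1)
inv : ℕ → ℚ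
inv zero    = 0ℚ
inv (suc m) = (+ 1) / suc m

h : Hypergraph → ℚ
h G = sumSubsets (v G) (λ A → if E G A then inv (v G C size A) else 0ℚ)
  where open Data.Bool using (if_then_else_)

Admissible : Hypergraph → ℕ → Hypergraph → Set
Admissible H n G = v G ≡ n × RSub G H × ¬ (H ⊆H G)

-- π(H) = L, i.e. π_n(H) = max{h_n(G) : G admissible} → L.
-- |π_n(H) - L| < ε  unfolds (π_n being a maximum over a finite nonempty family) to:
-- every admissible G has h_n(G) < L + ε and some admissible G has h_n(G) > L - ε.
PiEquals : Hypergraph → ℚ → Set
PiEquals H L = ∀ (ε : ℚ) → 0ℚ < ε → ∃ λ N → ∀ n → n ≥ N →
  (∀ G → Admissible H n G → h G < L + ε) × (∃ λ G → Admissible H n G × L - ε < h G)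

Adj2 : (H : Hypergraph) → Fin (v H) → Fin (v H) → Set
Adj2 H i j = i ≢ j × IsEdge H (⁅ i ⁆ ∪ ⁅ j ⁆)

Colourable2 : Hypergraph → ℕ → Set
Colourable2 H k = Σ (Fin (v H) → Fin k) λ c → ∀ i j → Adj2 H i j → c i ≢ c j

IsChromatic2 : Hypergraph → ℕ → Set
IsChromatic2 H k = Colourable2 H k × (∀ m → Colourable2 H m → k ℕ.≤ m)

Bipartite2 : Hypergraph → Set
Bipartite2 H = Colourable2 H 2

-- closed path P̄_m on x₁..x_m (m ≥ 1 given as suc m')
closedPath : ℕ → Hypergraph
closedPath m' = hg (suc m') λ A →
  ⌊ A ≟S ⁅ zero ⁆ ⌋ ∨ ⌊ A ≟S ⁅ fromℕ m' ⁆ ⌋ ∨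
  ⌊ any? (λ (i : Fin m') → A ≟S (⁅ inject₁ i ⁆ ∪ ⁅ suc i ⁆)) ⌋

-- P̄_{2k} for k ≥ 1 (k = suc k')
P̄2k : (k' : ℕ) → Hypergraph
P̄2k k' = closedPath (suc (ℕ._*_ 2 k'))

{-# OPTIONS --safe #-}
-- A graph G on n vertices with m marked vertices and S ordered adjacent pairs has h(G) = m/n + S/(n(n-1)).
--
-- Upper bounds. H maps homomorphically to a small pattern F: a clique with all vertices marked (the chromatic case,
-- and an edge with both ends marked when P̄₂ ⊆ H), P̄₄ (when the marked vertices of H are independent), or an edge with
-- one marked end (when H contains no P̄₂ₖ, so that all marked vertices of a component lie in the same colour class).
-- If h(G) exceeds the claimed value by a constant, G has a positive density of copies of F; the blow-up lemma turns
-- these into a blow-up of F large enough to contain H. Density is expressed by nested quantifiers "for at least n/k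
-- vertices x", which commute up to a change of k (double counting); this is all that the blow-up lemma needs.
--
-- Lower bounds. Blow-ups of a template on r colours: the complete (χ-1)-partite graph with all vertices marked;
-- half marked with all pairs not inside the marked half joined; 3/4 marked, complete bipartite between
-- marked and unmarked; and all vertices marked without 2-edges.
module Submission where

open import Defs
open import Data.Nat using (ℕ; zero; suc; _+_; _*_; _∸_; _≤_; _<_; z≤n; s≤s; _≤?_; _≡ᵇ_; _⊔_; NonZero)
open import Data.Nat.Properties using (≤-refl; ≤-trans; ≤-reflexive; <-≤-trans; ≤-<-trans; <⇒≤; ≰⇒>; ≤-pred; n≮n; 1+n≰n; n≤1+n; n<1+n; m≤m+n; m≤n+m; m≤m*n; m≤n*m; m≤m⊔n; m≤n⊔m; ≤-total; m+[n∸m]≡n; suc-injective; +-comm; +-assoc; +-identityʳ; *-comm; *-assoc; *-identityˡ; *-identityʳ; *-zeroʳ; *-distribˡ-+; *-distribʳ-+; +-mono-≤; +-monoˡ-≤; +-monoʳ-≤; +-monoʳ-<; *-mono-≤; *-mono-<; *-monoˡ-≤; *-monoʳ-≤; *-monoʳ-<; +-cancelʳ-≤; +-cancelʳ-≡; *-cancelˡ-≤; +-*-semiring; module ≤-Reasoning)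
open import Data.Nat.Combinatorics using (_C_; nC1≡n; nCk+nC[k+1]≡[n+1]C[k+1])
import Data.Nat.DivMod as DivMod
open import Data.Nat.DivMod using (_%_; m≡m%n+[m/n]*n; m%n≤n)
open import Data.Nat.Tactic.RingSolver using (solve-∀)
open import Algebra.Properties.Semiring.Sum +-*-semiring using (sum; ∑-comm; ∑-distrib-+; sum-cong-≗; *-distribˡ-sum)
open import Data.Integer as ℤ using (+_)
import Data.Integer.Properties as ℤP
open import Data.Rational as ℚ using (ℚ; 0ℚ; 1ℚ; _/_; _-_)
import Data.Rational.Properties as ℚP
open import Data.Rational.Unnormalised as ℚᵘ using (mkℚᵘ; *≡*; *≤*; *<*)
import Data.Rational.Unnormalised.Properties as ℚᵘP
open import Data.Bool as Bool using (Bool; true; false; _∧_; _∨_; not; if_then_else_)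
open import Data.Bool.Properties using (not-involutive)
open import Data.Empty using (⊥)
open import Data.Fin as F using (Fin; zero; suc; fromℕ; inject₁; splitAt; _↑ˡ_; _↑ʳ_)
open import Data.Fin.Properties as FP using (any?)
open import Data.Fin.Subset using (Subset; ⁅_⁆; _∪_; _∈_) renaming (∣_∣ to size; ⊥ to ∅)
open import Data.Fin.Subset.Properties using (_∈?_; x∈⁅x⁆; x∈⁅y⁆⇒x≡y; ∣⁅x⁆∣≡1; ∪-identityˡ; ∪-identityʳ; ∪-comm; ⊆-antisym; x∈p∪q⁻; x∈p∪q⁺)
open import Data.Vec using (Vec; []; _∷_; lookup; tabulate; replicate)
open import Data.Vec.Properties using (lookup∘tabulate; lookup-replicate; []=⇒lookup; lookup⇒[]=)
open import Data.Product using (Σ; ∃; ∃₂; _×_; _,_; proj₁; proj₂)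
open import Data.Sum using (_⊎_; inj₁; inj₂; [_,_]′)
open import Function using (_∘_)
open import Function.Definitions using (Injective)
open import Relation.Nullary using (¬_; Dec; yes; no; contradiction)
open import Relation.Nullary.Decidable using (⌊_⌋; _×-dec_; ¬?; ¬¬-excluded-middle)
open import Relation.Binary.PropositionalEquality using (_≡_; _≢_; refl; sym; trans; cong; cong₂; subst; subst₂; module ≡-Reasoning)

-- Counting and the blow-up lemma

-- The constants are maxima of quadratics in the fraction m of marked vertices. If the marked
-- vertices span at most (1 - 1/r)m² of all ordered pairs, then h is at most about m + 1 - m²/r. For
-- r ≥ 2 this increases on [0,1] up to 2 - 1/r at m = 1; for r = 1 it peaks inside, with value 5/4
-- at m = 1/2. Hence 5/4 is not the χ = 2 instance of the first formula, and the template for it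
-- marks one half. Likewise 9/8 is the maximum of m + 2m(1 - m), attained at m = 3/4. The last two
-- cases are separated by parity: P̄₂ₖ joins two marked vertices by an odd number of edges, while in
-- a bipartite graph whose sides are the marked and the unmarked vertices such walks have even
-- length. An upper bound has to refute that an H-free G is dense, so a copy of H is needed only up
-- to double negation. This makes room for a 2-colouring of H that is found only classically.

∧-elim : ∀ {a b} → a ∧ b ≡ true → a ≡ true × b ≡ true
∧-elim {true} {true} _ = refl , refl

∧-intro : ∀ {a b} → a ≡ true → b ≡ true → a ∧ b ≡ true
∧-intro refl refl = refl

dec-true⁻ : ∀ {a} {A : Set a} {d : Dec A} → ⌊ d ⌋ ≡ true → A
dec-true⁻ {d = yes a} _ = a

dec-true⁺ : ∀ {a} {A : Set a} {d : Dec A} → A → ⌊ d ⌋ ≡ true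
dec-true⁺ {d = yes _} _ = refl
dec-true⁺ {d = no ¬a} a = contradiction a ¬a

-- Stands in for subtraction in ℕ. The polynomial inequalities below are certified through it: a ≤ b
-- is a weighted sum of the hypotheses, and c + b ≤ d + a becomes a ring identity once an explicit
-- nonnegative slack is added on the left.
≤-transfer : ∀ {a b c d} → a ≤ b → c + b ≤ d + a → c ≤ d
≤-transfer {a} {b} {c} {d} a≤b h = +-cancelʳ-≤ a c d (≤-trans (+-monoʳ-≤ c a≤b) h)

⟦_⟧ : Bool → ℕ
⟦ b ⟧ = if b then 1 else 0

⟦⟧≤1 : ∀ b → ⟦ b ⟧ ≤ 1
⟦⟧≤1 true  = ≤-refl
⟦⟧≤1 false = z≤n

⟦⟧-mono : ∀ {a b} → (a ≡ true → b ≡ true) → ⟦ a ⟧ ≤ ⟦ b ⟧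
⟦⟧-mono {false} _ = z≤n
⟦⟧-mono {true} f rewrite f refl = ≤-refl

count : ∀ {n} → (Fin n → Bool) → ℕ
count P = sum (λ i → ⟦ P i ⟧)

pairs : ∀ {m n} → (Fin m → Fin n → Bool) → ℕ
pairs A = sum (λ i → count (A i))

sum-mono : ∀ {n} {f g : Fin n → ℕ} → (∀ i → f i ≤ g i) → sum f ≤ sum g
sum-mono {zero}  h = z≤n
sum-mono {suc n} h = +-mono-≤ (h zero) (sum-mono (h ∘ suc))

sum-const : ∀ n c → sum {n} (λ _ → c) ≡ n * c
sum-const zero    c = refl
sum-const (suc n) c = cong (λ z → c + z) (sum-const n c)

sum-scale : ∀ {n} c (f : Fin n → ℕ) → sum (λ i → c * f i) ≡ c * sum f
sum-scale c f = sym (*-distribˡ-sum c f)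

sum-+ : ∀ {n} (f g : Fin n → ℕ) → sum (λ i → f i + g i) ≡ sum f + sum g
sum-+ = ∑-distrib-+

count≤n : ∀ {n} (P : Fin n → Bool) → count P ≤ n
count≤n {n} P = ≤-trans (sum-mono (λ i → ⟦⟧≤1 (P i))) (≤-reflexive (trans (sum-const n 1) (*-identityʳ n)))

count-mono : ∀ {n} {P R : Fin n → Bool} → (∀ i → P i ≡ true → R i ≡ true) → count P ≤ count R
count-mono h = sum-mono (λ i → ⟦⟧-mono (h i))

sum-indicator : ∀ {n} (v : Fin n) (f : Fin n → ℕ) → sum (λ x → ⟦ ⌊ x F.≟ v ⌋ ⟧ * f x) ≡ f v
sum-indicator {suc n} zero f = begin
  f zero + 0 + sum {n} (λ _ → 0) ≡⟨ cong (λ z → f zero + 0 + z) (trans (sum-const n 0) (*-zeroʳ n)) ⟩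
  f zero + 0 + 0                 ≡⟨ trans (+-identityʳ _) (+-identityʳ _) ⟩
  f zero ∎
  where open ≡-Reasoning
sum-indicator {suc n} (suc v) f = trans (sum-cong-≗ (λ x → cong (λ b → ⟦ b ⟧ * f (suc x)) (lem x))) (sum-indicator v (f ∘ suc))
  where
  lem : ∀ x → ⌊ suc x F.≟ suc v ⌋ ≡ ⌊ x F.≟ v ⌋
  lem x with x F.≟ v
  ... | yes _ = refl
  ... | no _  = refl

count-singleton : ∀ {n} (v : Fin n) → count (λ x → ⌊ x F.≟ v ⌋) ≡ 1
count-singleton v = trans (sum-cong-≗ {x = λ x → ⟦ ⌊ x F.≟ v ⌋ ⟧} (λ x → sym (*-identityʳ _))) (sum-indicator v (λ _ → 1))

abstract
  many : ∀ {n} → ℕ → (Fin n → Bool) → Bool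
  many {n} k P = ⌊ n ≤? k * count P ⌋

  many⁻ : ∀ {n} k (P : Fin n → Bool) → many k P ≡ true → n ≤ k * count P
  many⁻ _ _ = dec-true⁻

  many⁺ : ∀ {n} k (P : Fin n → Bool) → n ≤ k * count P → many k P ≡ true
  many⁺ _ _ = dec-true⁺

¬many : ∀ {n} k (P : Fin n → Bool) → many k P ≡ false → k * count P ≤ n
¬many {n} k P h with n ≤? k * count P
... | no ¬p = <⇒≤ (≰⇒> ¬p)
... | yes p = contradiction (trans (sym (many⁺ k P p)) h) (λ ())

many-mono : ∀ {n k k'} {P R : Fin n → Bool} → k ≤ k' → (∀ x → P x ≡ true → R x ≡ true) →
            many k P ≡ true → many k' R ≡ true
many-mono {k = k} {k'} {P} {R} k≤k' h m = many⁺ k' R (≤-trans (many⁻ k P m) (*-mono-≤ k≤k' (count-mono h)))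

square-cancel-≤ : ∀ n m → n * n ≤ n * m → n ≤ m
square-cancel-≤ zero    m _ = z≤n
square-cancel-≤ (suc n) m h = *-cancelˡ-≤ (suc n) h

-- Rows with fewer than n / 2K entries carry at most half of the n² / K entries of A.
dense⇒many : ∀ {n} K (A : Fin n → Fin n → Bool) → n * n ≤ K * pairs A →
             many (2 * K) (λ x → many (2 * K) (A x)) ≡ true
dense⇒many {n} K A dense = many⁺ (2 * K) big (square-cancel-≤ n _ (≤-trans (≤-transfer {a = 2 * (n * n)} (*-monoʳ-≤ 2 dense) step) (≤-reflexive (eq₂ (2 * K) n (count big)))))
  where
  big : Fin n → Bool
  big x = many (2 * K) (A x)
  row : ∀ x → 2 * K * count (A x) ≤ 2 * K * n * ⟦ big x ⟧ + n
  row x with big x in eq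
  ... | true  = ≤-trans (*-monoʳ-≤ (2 * K) (count≤n (A x))) (≤-trans (≤-reflexive (sym (*-identityʳ _))) (m≤m+n _ n))
  ... | false = ≤-trans (¬many (2 * K) (A x) eq) (m≤n+m n _)
  eq₂ : ∀ k n c → k * n * c ≡ n * (k * c)
  eq₂ = solve-∀
  eq₁ : ∀ k n c → n * n + (k * n * c + n * n) ≡ k * n * c + 2 * (n * n)
  eq₁ = solve-∀
  total : 2 * (K * pairs A) ≤ 2 * K * n * count big + n * n
  total = begin
    2 * (K * pairs A)                             ≡⟨ sym (*-assoc 2 K _) ⟩
    2 * K * pairs A                               ≡⟨ sum-scale (2 * K) (count ∘ A) ⟨
    sum (λ x → 2 * K * count (A x))               ≤⟨ sum-mono row ⟩
    sum (λ x → 2 * K * n * ⟦ big x ⟧ + n)         ≡⟨ sum-+ (λ x → 2 * K * n * ⟦ big x ⟧) (λ _ → n) ⟩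
    sum (λ x → 2 * K * n * ⟦ big x ⟧) + sum {n} (λ _ → n) ≡⟨ cong₂ _+_ (sum-scale (2 * K * n) (λ x → ⟦ big x ⟧)) (sum-const n n) ⟩
    2 * K * n * count big + n * n ∎
    where open ≤-Reasoning
  step : n * n + 2 * (K * pairs A) ≤ 2 * K * n * count big + 2 * (n * n)
  step = ≤-trans (+-monoʳ-≤ (n * n) total) (≤-reflexive (eq₁ (2 * K) n (count big)))

many⇒dense : ∀ {n} k (A : Fin n → Fin n → Bool) → many k (λ x → many k (A x)) ≡ true →
             n * n ≤ k * k * pairs A
many⇒dense {n} k A h = begin
  n * n                              ≤⟨ *-monoʳ-≤ n (many⁻ k big h) ⟩
  n * (k * count big)                ≡⟨ eq n k (count big) ⟩
  k * (n * count big)                ≡⟨ cong (k *_) (sum-scale n (λ x → ⟦ big x ⟧)) ⟨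
  k * sum (λ x → n * ⟦ big x ⟧)      ≤⟨ *-monoʳ-≤ k (sum-mono row) ⟩
  k * sum (λ x → k * count (A x))    ≡⟨ cong (k *_) (sum-scale k (count ∘ A)) ⟩
  k * (k * pairs A)                  ≡⟨ *-assoc k k _ ⟨
  k * k * pairs A ∎
  where
  open ≤-Reasoning
  big : Fin n → Bool
  big x = many k (A x)
  eq : ∀ n k c → n * (k * c) ≡ k * (n * c)
  eq = solve-∀
  row : ∀ x → n * ⟦ big x ⟧ ≤ k * count (A x)
  row x with big x in eq
  ... | true  = ≤-trans (≤-reflexive (*-identityʳ n)) (many⁻ k (A x) eq)
  ... | false = ≤-trans (≤-reflexive (*-zeroʳ n)) z≤n

-- Both orders of quantification are compared with the number of pairs, which transposition
-- preserves. The cost is the passage from k to 2k².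
many-swap : ∀ {n} k (A : Fin n → Fin n → Bool) → many k (λ x → many k (A x)) ≡ true →
            many (2 * (k * k)) (λ y → many (2 * (k * k)) (λ x → A x y)) ≡ true
many-swap {n} k A h = dense⇒many (k * k) (λ y x → A x y)
  (subst (λ s → n * n ≤ k * k * s) (∑-comm (λ x y → ⟦ A x y ⟧)) (many⇒dense k A h))

-- Boolean-valued, so that a nested quantifier is again something to be counted by an outer one.
manyᵗ : ∀ {n} → ℕ → (s : ℕ) → (Vec (Fin n) s → Bool) → Bool
manyᵗ k zero    A = A []
manyᵗ k (suc s) A = many k (λ x → manyᵗ k s (λ w → A (x ∷ w)))

manyᵗ-mono : ∀ {n k k'} s {A B : Vec (Fin n) s → Bool} → k ≤ k' → (∀ w → A w ≡ true → B w ≡ true) →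
             manyᵗ k s A ≡ true → manyᵗ k' s B ≡ true
manyᵗ-mono zero    k≤k' h m = h [] m
manyᵗ-mono (suc s) k≤k' h m = many-mono k≤k' (λ x → manyᵗ-mono s k≤k' (λ w → h (x ∷ w))) m

k≤2kk : ∀ k → k ≤ 2 * (k * k)
k≤2kk zero = z≤n
k≤2kk k@(suc _) = ≤-trans (m≤m*n k k) (m≤n*m (k * k) 2)

-- The quantifier over x moves inwards past one coordinate at a time. It is essential that k'
-- depends on m and k only and is fixed before n and A: the size thresholds further on must be
-- uniform in the graph.
many-manyᵗ-swap : ∀ m k → Σ ℕ λ k' → k ≤ k' × (∀ {n} (A : Fin n → Vec (Fin n) m → Bool) →
  many k (λ x → manyᵗ k m (A x)) ≡ true → manyᵗ k' m (λ w → many k' (λ x → A x w)) ≡ true)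
many-manyᵗ-swap zero    k = k , ≤-refl , λ A h → h
many-manyᵗ-swap (suc m) k with many-manyᵗ-swap m (2 * (k * k))
... | k' , 2kk≤k' , swap = k' , ≤-trans (k≤2kk k) 2kk≤k' , λ A h →
  many-mono 2kk≤k' (λ y → swap (λ x w → A x (y ∷ w)) ∘ many-mono ≤-refl (λ x → manyᵗ-mono m (k≤2kk k) (λ _ p → p)))
    (many-swap k (λ x y → manyᵗ k m (λ w → A x (y ∷ w))) h)

manyᵗ-swap : ∀ a b k → Σ ℕ λ k' → k ≤ k' × (∀ {n} (A : Vec (Fin n) a → Vec (Fin n) b → Bool) →
  manyᵗ k a (λ u → manyᵗ k b (A u)) ≡ true → manyᵗ k' b (λ w → manyᵗ k' a (λ u → A u w)) ≡ true)
manyᵗ-swap zero    b k = k , ≤-refl , λ A h → h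
manyᵗ-swap (suc a) b k with manyᵗ-swap a b k
... | k₁ , k≤k₁ , swap₁ with many-manyᵗ-swap b k₁
... | k₂ , k₁≤k₂ , swap₂ = k₂ , ≤-trans k≤k₁ k₁≤k₂ , λ A h →
  manyᵗ-mono b ≤-refl (λ w → many-mono ≤-refl (λ x → manyᵗ-mono a k₁≤k₂ (λ _ p → p)))
    (swap₂ (λ x w → manyᵗ k₁ a (λ u → A (x ∷ u) w))
      (many-mono k≤k₁ (λ x → swap₁ (λ u → A (x ∷ u))) h))

all : ∀ {n t} → (Fin n → Bool) → Vec (Fin n) t → Bool
all P []       = true
all P (x ∷ xs) = P x ∧ all P xs

all-lookup : ∀ {n t} (P : Fin n → Bool) (xs : Vec (Fin n) t) → all P xs ≡ true → ∀ i → P (lookup xs i) ≡ true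
all-lookup P (x ∷ xs) h zero    = proj₁ (∧-elim h)
all-lookup P (x ∷ xs) h (suc i) = all-lookup P xs (proj₂ (∧-elim h)) i

-- The t choices are independent, so no parameter is lost. The entries may coincide; distinctness is
-- arranged later by `manyᵗ⇒∃-distinct`.
many-dup : ∀ {n} k t (P : Fin n → Bool) → many k P ≡ true → manyᵗ k t (all P) ≡ true
many-dup k zero    P h = refl
many-dup k (suc t) P h = many-mono ≤-refl (λ x p → manyᵗ-mono t ≤-refl (λ w q → ∧-intro p q) (many-dup k t P h)) h

-- Swap, copy, swap back: with w in front, x ranges over a large set that depends on w, so t values
-- of x can be drawn from it; the t-tuple then moves to the front again. The outcome is t vertices
-- with many common continuations w, which is one step of the blow-up.
many-blowup : ∀ m t k → Σ ℕ λ k' → ∀ {n} (A : Fin n → Vec (Fin n) m → Bool) →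
  many k (λ x → manyᵗ k m (A x)) ≡ true → manyᵗ k' t (λ xs → manyᵗ k' m (λ w → all (λ x → A x w) xs)) ≡ true
many-blowup m t k with many-manyᵗ-swap m k
... | k₁ , k≤k₁ , swap₁ with manyᵗ-swap m t k₁
... | k₂ , k₁≤k₂ , swap₂ = k₂ , λ A h →
  swap₂ (λ w → all (λ x → A x w)) (manyᵗ-mono m ≤-refl (λ w → many-dup k₁ t (λ x → A x w)) (swap₁ A h))

many⇒∃-avoiding : ∀ {n} k ℓ (P bad : Fin n → Bool) → many k P ≡ true → count bad ≤ ℓ → k * ℓ < n →
  ∃ λ x → P x ≡ true × bad x ≡ false
many⇒∃-avoiding {n} k ℓ P bad h bad≤ℓ kℓ<n with any? (λ x → (P x Bool.≟ true) ×-dec (bad x Bool.≟ false))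
... | yes found = found
... | no none = contradiction
    (≤-<-trans (≤-trans (many⁻ k P h) (*-monoʳ-≤ k (≤-trans (count-mono P⊆bad) bad≤ℓ))) kℓ<n) (n≮n n)
  where
  P⊆bad : ∀ x → P x ≡ true → bad x ≡ true
  P⊆bad x Px with bad x in eq
  ... | true  = refl
  ... | false = contradiction (x , Px , eq) none

insert : ∀ {n} → Fin n → (Fin n → Bool) → Fin n → Bool
insert x bad y = ⌊ y F.≟ x ⌋ ∨ bad y

count-insert : ∀ {n} (x : Fin n) bad {ℓ} → count bad ≤ ℓ → count (insert x bad) ≤ suc ℓ
count-insert x bad {ℓ} h = begin
  count (insert x bad)                                ≤⟨ sum-mono (λ y → ∨≤ ⌊ y F.≟ x ⌋ (bad y)) ⟩
  sum (λ y → ⟦ ⌊ y F.≟ x ⌋ ⟧ + ⟦ bad y ⟧)              ≡⟨ sum-+ (λ y → ⟦ ⌊ y F.≟ x ⌋ ⟧) (λ y → ⟦ bad y ⟧) ⟩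
  count (λ y → ⌊ y F.≟ x ⌋) + count bad                ≡⟨ cong (_+ count bad) (count-singleton x) ⟩
  suc (count bad)                                     ≤⟨ s≤s h ⟩
  suc ℓ ∎
  where
  open ≤-Reasoning
  ∨≤ : ∀ a b → ⟦ a ∨ b ⟧ ≤ ⟦ a ⟧ + ⟦ b ⟧
  ∨≤ true  b = s≤s z≤n
  ∨≤ false b = ≤-refl

insert-false : ∀ {n} (x y : Fin n) bad → insert x bad y ≡ false → y ≢ x × bad y ≡ false
insert-false x y bad h with y F.≟ x
... | no y≢x = y≢x , h

insertAll : ∀ {n t} → Vec (Fin n) t → (Fin n → Bool) → Fin n → Bool
insertAll []       bad = bad
insertAll (x ∷ xs) bad = insertAll xs (insert x bad)

insertAll-false : ∀ {n t} (xs : Vec (Fin n) t) bad y → insertAll xs bad y ≡ false →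
  bad y ≡ false × (∀ i → y ≢ lookup xs i)
insertAll-false []       bad y h = h , λ ()
insertAll-false (x ∷ xs) bad y h with insertAll-false xs (insert x bad) y h
... | h₁ , h₂ with insert-false x y bad h₁
... | y≢x , h₃ = h₃ , λ { zero → y≢x ; (suc i) → h₂ i }

count-insertAll : ∀ {n t} (xs : Vec (Fin n) t) bad {ℓ} → count bad ≤ ℓ → count (insertAll xs bad) ≤ t + ℓ
count-insertAll []       bad h = h
count-insertAll {t = suc t} (x ∷ xs) bad {ℓ} h =
  ≤-trans (count-insertAll xs (insert x bad) (count-insert x bad h)) (≤-reflexive (eq t ℓ))
  where
  eq : ∀ t ℓ → t + suc ℓ ≡ suc t + ℓ
  eq = solve-∀

-- Greedy choice in which every chosen vertex joins the forbidden set. The sum t + ℓ stays constant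
-- along the recursion, so one size condition serves all steps.
manyᵗ⇒∃-distinct : ∀ {n} k ℓ t (A : Vec (Fin n) t → Bool) (bad : Fin n → Bool) →
  manyᵗ k t A ≡ true → count bad ≤ ℓ → k * (t + ℓ) < n →
  ∃ λ xs → A xs ≡ true × (∀ i → bad (lookup xs i) ≡ false) × (∀ i j → lookup xs i ≡ lookup xs j → i ≡ j)
manyᵗ⇒∃-distinct k ℓ zero    A bad h _ _ = [] , h , (λ ()) , (λ ())
manyᵗ⇒∃-distinct {n} k ℓ (suc t) A bad h bad≤ℓ small
  with many⇒∃-avoiding k ℓ _ bad h bad≤ℓ (≤-<-trans (*-monoʳ-≤ k (m≤n+m ℓ (suc t))) small)
... | x , hx , xgood
  with manyᵗ⇒∃-distinct k (suc ℓ) t (λ w → A (x ∷ w)) (insert x bad) hx (count-insert x bad bad≤ℓ)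
         (subst (λ z → k * z < n) (eq t ℓ) small)
  where
  eq : ∀ t ℓ → suc t + ℓ ≡ t + suc ℓ
  eq = solve-∀
... | xs , hxs , good , inj = (x ∷ xs) , hxs , good' , inj'
  where
  fresh : ∀ i → lookup xs i ≢ x × bad (lookup xs i) ≡ false
  fresh i = insert-false x (lookup xs i) bad (good i)
  good' : ∀ i → bad (lookup (x ∷ xs) i) ≡ false
  good' zero    = xgood
  good' (suc i) = proj₂ (fresh i)
  inj' : ∀ i j → lookup (x ∷ xs) i ≡ lookup (x ∷ xs) j → i ≡ j
  inj' zero    zero    _ = refl
  inj' zero    (suc j) e = contradiction (sym e) (proj₁ (fresh j))
  inj' (suc i) zero    e = contradiction e (proj₁ (fresh i))
  inj' (suc i) (suc j) e = cong suc (inj i j e)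

sections : ∀ {s t} {X : Set} → Vec (Vec X t) s → Vec (Fin t) s → Vec X s
sections []       []       = []
sections (T ∷ Ts) (j ∷ js) = lookup T j ∷ sections Ts js

-- Coordinates are blown up one by one: after the first class xs is fixed, the recursion continues
-- with the relation "A holds for every x in xs" and with xs forbidden. The second conclusion
-- compares only positions i and j. That is enough for `embed`, which puts vertex i of H at position
-- i of its class.
blowup : ∀ s t k ℓ → Σ ℕ λ N → ∀ {n} → N < n → (A : Vec (Fin n) s → Bool) (bad : Fin n → Bool) →
  count bad ≤ ℓ → manyᵗ k s A ≡ true →
  Σ (Vec (Vec (Fin n) t) s) λ T →
    (∀ a i → bad (lookup (lookup T a) i) ≡ false) ×
    (∀ a b i j → lookup (lookup T a) i ≡ lookup (lookup T b) j → i ≡ j) ×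
    (∀ js → A (sections T js) ≡ true)
blowup zero    t k ℓ = 0 , λ _ A bad _ h → [] , (λ ()) , (λ ()) , λ { [] → h }
blowup (suc s) t k ℓ with many-blowup s t k
... | k' , blow with blowup s t k' (t + ℓ)
... | N , rec = k' * (t + ℓ) + N , build
  where
  build : ∀ {n} → k' * (t + ℓ) + N < n → (A : Vec (Fin n) (suc s) → Bool) (bad : Fin n → Bool) →
    count bad ≤ ℓ → manyᵗ k (suc s) A ≡ true →
    Σ (Vec (Vec (Fin n) t) (suc s)) λ T →
      (∀ a i → bad (lookup (lookup T a) i) ≡ false) ×
      (∀ a b i j → lookup (lookup T a) i ≡ lookup (lookup T b) j → i ≡ j) ×
      (∀ js → A (sections T js) ≡ true)
  build large A bad bad≤ℓ h
    with manyᵗ⇒∃-distinct k' ℓ t _ bad (blow (λ x w → A (x ∷ w)) h) bad≤ℓ (≤-<-trans (m≤m+n _ N) large)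
  ... | xs , hxs , good , inj
    with rec (≤-<-trans (m≤n+m N _) large) _ (insertAll xs bad) (count-insertAll xs bad bad≤ℓ) hxs
  ... | Ts , goods , injs , As = (xs ∷ Ts) , good' , inj' , As'
    where
    fresh : ∀ a i → bad (lookup (lookup Ts a) i) ≡ false × (∀ j → lookup (lookup Ts a) i ≢ lookup xs j)
    fresh a i = insertAll-false xs bad _ (goods a i)
    good' : ∀ a i → bad (lookup (lookup (xs ∷ Ts) a) i) ≡ false
    good' zero    i = good i
    good' (suc a) i = proj₁ (fresh a i)
    inj' : ∀ a b i j → lookup (lookup (xs ∷ Ts) a) i ≡ lookup (lookup (xs ∷ Ts) b) j → i ≡ j
    inj' zero    zero    i j e = inj i j e
    inj' zero    (suc b) i j e = contradiction (sym e) (proj₂ (fresh b j) i)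
    inj' (suc a) zero    i j e = contradiction e (proj₂ (fresh a i) j)
    inj' (suc a) (suc b) i j e = injs a b i j e
    As' : ∀ js → A (sections (xs ∷ Ts) js) ≡ true
    As' (j ∷ js) = all-lookup (λ x → A (x ∷ sections Ts js)) xs (As js) j

-- Supersaturation

sum² : ∀ {m n} → (Fin m → Fin n → ℕ) → ℕ
sum² f = sum (λ i → sum (f i))

sum²-mono : ∀ {m n} {f g : Fin m → Fin n → ℕ} → (∀ i j → f i j ≤ g i j) → sum² f ≤ sum² g
sum²-mono h = sum-mono (λ i → sum-mono (h i))

sum²-+ : ∀ {m n} (f g : Fin m → Fin n → ℕ) → sum² (λ i j → f i j + g i j) ≡ sum² f + sum² g
sum²-+ f g = trans (sum-cong-≗ (λ i → sum-+ (f i) (g i))) (sum-+ (λ i → sum (f i)) (λ i → sum (g i)))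

pairs-∧ : ∀ {m n} (P : Fin m → Bool) (R : Fin n → Bool) → pairs (λ u v → P u ∧ R v) ≡ count P * count R
pairs-∧ {m} {n} P R = begin
  pairs (λ u v → P u ∧ R v)                    ≡⟨ sum-cong-≗ {x = λ u → count (λ v → P u ∧ R v)} row ⟩
  sum (λ u → count R * ⟦ P u ⟧)                ≡⟨ sum-scale (count R) (λ u → ⟦ P u ⟧) ⟩
  count R * count P                            ≡⟨ *-comm (count R) (count P) ⟩
  count P * count R ∎
  where
  open ≡-Reasoning
  row : ∀ u → count (λ v → P u ∧ R v) ≡ count R * ⟦ P u ⟧
  row u with P u
  ... | true  = sym (*-identityʳ _)
  ... | false = trans (trans (sum-const n 0) (*-zeroʳ n)) (sym (*-zeroʳ (count R)))

count-not : ∀ {n} (P : Fin n → Bool) → count P + count (not ∘ P) ≡ n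
count-not {n} P = begin
  count P + count (not ∘ P)                ≡⟨ sum-+ (λ i → ⟦ P i ⟧) (λ i → ⟦ not (P i) ⟧) ⟨
  sum (λ i → ⟦ P i ⟧ + ⟦ not (P i) ⟧)       ≡⟨ sum-cong-≗ {x = λ i → ⟦ P i ⟧ + ⟦ not (P i) ⟧} (λ i → one (P i)) ⟩
  sum {n} (λ _ → 1)                        ≡⟨ trans (sum-const n 1) (*-identityʳ n) ⟩
  n ∎
  where
  open ≡-Reasoning
  one : ∀ b → ⟦ b ⟧ + ⟦ not b ⟧ ≡ 1
  one true  = refl
  one false = refl

2xy≤x²+y² : ∀ x y → 2 * (x * y) ≤ x * x + y * y
2xy≤x²+y² x y with ≤-total x y
... | inj₁ x≤y = subst (λ y → 2 * (x * y) ≤ x * x + y * y) (m+[n∸m]≡n x≤y) (≤-trans (m≤m+n _ _) (≤-reflexive (eq x (y ∸ x))))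
  where
  eq : ∀ x d → 2 * (x * (x + d)) + d * d ≡ x * x + (x + d) * (x + d)
  eq = solve-∀
... | inj₂ y≤x = subst (λ x → 2 * (x * y) ≤ x * x + y * y) (m+[n∸m]≡n y≤x) (≤-trans (m≤m+n _ _) (≤-reflexive (eq y (x ∸ y))))
  where
  eq : ∀ y d → 2 * ((y + d) * y) + d * d ≡ (y + d) * (y + d) + y * y
  eq = solve-∀

-- The candidate set shrinks to the neighbours of each chosen vertex, so the recursion runs parallel
-- to that of `manyᵗ` and a greedy argument can follow it.
cliqueIn : ∀ {n} → (Fin n → Fin n → Bool) → ∀ {s} → (Fin n → Bool) → Vec (Fin n) s → Bool
cliqueIn e W []      = true
cliqueIn e W (x ∷ w) = W x ∧ cliqueIn e (λ y → W y ∧ e x y) w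

cliqueIn-mono : ∀ {n} (e : Fin n → Fin n → Bool) {s} {W W' : Fin n → Bool} → (∀ x → W x ≡ true → W' x ≡ true) →
  (w : Vec (Fin n) s) → cliqueIn e W w ≡ true → cliqueIn e W' w ≡ true
cliqueIn-mono e W⊆ []      h = refl
cliqueIn-mono e W⊆ (x ∷ w) h = ∧-intro (W⊆ x (proj₁ (∧-elim h)))
  (cliqueIn-mono e (λ y p → ∧-intro (W⊆ y (proj₁ (∧-elim p))) (proj₂ (∧-elim p))) w (proj₂ (∧-elim h)))

cliqueIn-⊆ : ∀ {n} (e : Fin n → Fin n → Bool) {s} (W : Fin n → Bool) (w : Vec (Fin n) s) →
  cliqueIn e W w ≡ true → ∀ i → W (lookup w i) ≡ true
cliqueIn-⊆ e W (x ∷ w) h zero    = proj₁ (∧-elim h)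
cliqueIn-⊆ e W (x ∷ w) h (suc i) = proj₁ (∧-elim (cliqueIn-⊆ e (λ y → W y ∧ e x y) w (proj₂ (∧-elim h)) i))

-- The vertices of P̄₄ in the order x₂, x₃, x₁, x₄.
P₄-pattern : ∀ {n} → (Fin n → Bool) → (Fin n → Fin n → Bool) → Vec (Fin n) 4 → Bool
P₄-pattern M e (u ∷ v ∷ x ∷ y ∷ []) = (M x ∧ e u x) ∧ ((M y ∧ e v y) ∧ e u v)

edge-pattern : ∀ {n} → (Fin n → Bool) → (Fin n → Fin n → Bool) → Vec (Fin n) 2 → Bool
edge-pattern M e (u ∷ v ∷ []) = M u ∧ e u v

module _ {n : ℕ} (e : Fin n → Fin n → Bool) (e-sym : ∀ u v → e u v ≡ true → e v u ≡ true) where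

  cliqueIn-adj : ∀ {s} (W : Fin n → Bool) (w : Vec (Fin n) s) → cliqueIn e W w ≡ true →
    ∀ i j → i ≢ j → e (lookup w i) (lookup w j) ≡ true
  cliqueIn-adj W (x ∷ w) h zero    zero    i≢j = contradiction refl i≢j
  cliqueIn-adj W (x ∷ w) h zero    (suc j) i≢j =
    proj₂ (∧-elim {W (lookup w j)} (cliqueIn-⊆ e (λ y → W y ∧ e x y) w (proj₂ (∧-elim h)) j))
  cliqueIn-adj W (x ∷ w) h (suc i) zero    i≢j =
    e-sym _ _ (proj₂ (∧-elim {W (lookup w i)} (cliqueIn-⊆ e (λ y → W y ∧ e x y) w (proj₂ (∧-elim h)) i)))
  cliqueIn-adj W (x ∷ w) h (suc i) (suc j) i≢j =
    cliqueIn-adj (λ y → W y ∧ e x y) w (proj₂ (∧-elim h)) i j (i≢j ∘ cong suc)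

  degIn : (Fin n → Bool) → Fin n → ℕ
  degIn U v = count (λ y → U y ∧ e v y)

  inside : (Fin n → Bool) → ℕ
  inside U = pairs (λ x y → U x ∧ (U y ∧ e x y))

  remove : Fin n → (Fin n → Bool) → Fin n → Bool
  remove v U x = U x ∧ not ⌊ x F.≟ v ⌋

  count-remove : ∀ v U → U v ≡ true → count U ≡ suc (count (remove v U))
  count-remove v U Uv = begin
    count U                                                   ≡⟨ sum-cong-≗ {x = λ x → ⟦ U x ⟧} pt ⟩
    sum (λ x → ⟦ ⌊ x F.≟ v ⌋ ⟧ + ⟦ remove v U x ⟧)            ≡⟨ sum-+ (λ x → ⟦ ⌊ x F.≟ v ⌋ ⟧) (λ x → ⟦ remove v U x ⟧) ⟩
    count (λ x → ⌊ x F.≟ v ⌋) + count (remove v U)            ≡⟨ cong (_+ count (remove v U)) (count-singleton v) ⟩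
    suc (count (remove v U)) ∎
    where
    open ≡-Reasoning
    pt : ∀ x → ⟦ U x ⟧ ≡ ⟦ ⌊ x F.≟ v ⌋ ⟧ + ⟦ remove v U x ⟧
    pt x with x F.≟ v
    ... | yes refl rewrite Uv = refl
    ... | no _ with U x
    ... | true  = refl
    ... | false = refl

  -- Pairs are ordered, so v accounts for its degree twice. Only symmetry of e is available here; a
  -- possible pair (v, v) is counted twice on the right, which the inequality permits.
  inside-remove : ∀ v U → inside U ≤ inside (remove v U) + degIn U v + degIn U v
  inside-remove v U = begin
    inside U
      ≤⟨ sum²-mono pt ⟩
    sum² (λ x y → rest x y + at x * deg y + at y * deg x)
      ≡⟨ sum²-+ (λ x y → rest x y + at x * deg y) (λ x y → at y * deg x) ⟩
    sum² (λ x y → rest x y + at x * deg y) + sum² (λ x y → at y * deg x)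
      ≡⟨ cong₂ _+_ (sum²-+ rest (λ x y → at x * deg y)) (sum-cong-≗ (λ x → sum-indicator v (λ _ → deg x))) ⟩
    inside (remove v U) + sum² (λ x y → at x * deg y) + degIn U v
      ≡⟨ cong (λ z → inside (remove v U) + z + degIn U v) (trans (sum-cong-≗ (λ x → sum-scale (at x) deg)) (sum-indicator v (λ _ → degIn U v))) ⟩
    inside (remove v U) + degIn U v + degIn U v ∎
    where
    open ≤-Reasoning
    at deg : Fin n → ℕ
    at x = ⟦ ⌊ x F.≟ v ⌋ ⟧
    deg y = ⟦ U y ∧ e v y ⟧
    rest : Fin n → Fin n → ℕ
    rest x y = ⟦ remove v U x ∧ (remove v U y ∧ e x y) ⟧
    pt : ∀ x y → ⟦ U x ∧ (U y ∧ e x y) ⟧ ≤ rest x y + at x * deg y + at y * deg x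
    pt x y with x F.≟ v
    ... | yes refl = ≤-trans (⟦⟧-mono (λ h → proj₂ (∧-elim {U x} h)))
                       (≤-trans (≤-reflexive (sym (*-identityˡ _))) (≤-trans (m≤n+m (1 * deg y) ⟦ (U x ∧ false) ∧ ((U y ∧ not ⌊ y F.≟ x ⌋) ∧ e x y) ⟧) (m≤m+n _ (⟦ ⌊ y F.≟ x ⌋ ⟧ * deg x))))
    ... | no x≢v with y F.≟ v
    ... | yes refl = ≤-trans (⟦⟧-mono (λ h → ∧-intro (proj₁ (∧-elim {U x} h)) (e-sym x v (proj₂ (∧-elim {U v} (proj₂ (∧-elim {U x} h)))))))
                       (≤-trans (≤-reflexive (sym (*-identityˡ _))) (m≤n+m (1 * deg x) (⟦ (U x ∧ true) ∧ ((U y ∧ false) ∧ e x y) ⟧ + 0)))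
    ... | no y≢v = ≤-trans (⟦⟧-mono (λ h → let (p , q) = ∧-elim {U x} h ; (r , s) = ∧-elim {U y} q
                                         in ∧-intro (∧-intro p refl) (∧-intro (∧-intro r refl) s)))
                     (≤-trans (m≤m+n _ _) (m≤m+n _ _))

  -- Deleting a vertex v with b · deg v < a |U| does not decrease b · inside U ∸ a |U| (|U| + 1).
  clean : ∀ a b ℓ (U : Fin n → Bool) → count U ≤ ℓ →
    a * (count U * (count U + 1)) + n * n ≤ b * inside U →
    ∃ λ U' → (∀ x → U' x ≡ true → U x ≡ true)
           × (∀ v → U' v ≡ true → a * count U' ≤ b * degIn U' v)
           × n * n ≤ b * inside U'
  clean a b ℓ U U≤ℓ H
    with any? (λ v → (U v Bool.≟ true) ×-dec ¬? (a * count U ≤? b * degIn U v))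
  ... | no none = U , (λ _ p → p) , high , ≤-trans (m≤n+m _ _) H
    where
    high : ∀ v → U v ≡ true → a * count U ≤ b * degIn U v
    high v Uv with a * count U ≤? b * degIn U v
    ... | yes p = p
    ... | no ¬p = contradiction (v , Uv , ¬p) none
  ... | yes (v , Uv , low) with ℓ | count-remove v U Uv
  ... | zero   | cU = contradiction (subst (_≤ 0) cU U≤ℓ) λ ()
  ... | suc ℓ' | cU with clean a b ℓ' (remove v U) (≤-pred (subst (_≤ suc ℓ') cU U≤ℓ)) H'
    where
    arith : ∀ u' D D' d N → D ≤ D' + d + d → b * d ≤ a * suc u' →
      a * (suc u' * (suc u' + 1)) + N ≤ b * D → a * (u' * (u' + 1)) + N ≤ b * D'
    arith u' D D' d N h₁ h₂ h₃ = ≤-transfer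
      (+-mono-≤ (≤-trans h₃ (*-monoʳ-≤ b h₁)) (+-mono-≤ h₂ h₂))
      (≤-reflexive (eq a b u' D' d N))
      where
      eq : ∀ a b u' D' d N → a * (u' * (u' + 1)) + N + (b * (D' + d + d) + (a * suc u' + a * suc u'))
         ≡ b * D' + (a * (suc u' * (suc u' + 1)) + N + (b * d + b * d))
      eq = solve-∀
    H' : a * (count (remove v U) * (count (remove v U) + 1)) + n * n ≤ b * inside (remove v U)
    H' = arith (count (remove v U)) (inside U) _ (degIn U v) (n * n) (inside-remove v U)
           (≤-trans (<⇒≤ (≰⇒> low)) (≤-reflexive (cong (a *_) cU)))
           (subst (λ u → a * (u * (u + 1)) + n * n ≤ b * inside U) cU H)
  ... | U' , U'⊆ , high , big = U' , (λ x p → proj₁ (∧-elim (U'⊆ x p))) , high , big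

  -- Each chosen vertex of U rules out at most (g / b) |U| of the remaining candidates W.
  greedy : ∀ b g (U : Fin n → Bool) → n ≤ b * count U →
    (∀ v → U v ≡ true → b * count U ≤ b * degIn U v + g * count U) →
    ∀ i (W : Fin n → Bool) → (∀ x → W x ≡ true → U x ≡ true) → (i * g + 1) * count U ≤ b * count W →
    manyᵗ (b * b) (suc i) (cliqueIn e W) ≡ true
  greedy b g U n≤bu high i W W⊆U h = many-mono ≤-refl (extend i h) manyW
    where
    manyW : many (b * b) W ≡ true
    manyW = many⁺ (b * b) W (begin
      n                        ≤⟨ n≤bu ⟩
      b * count U              ≡⟨ cong (b *_) (*-identityˡ (count U)) ⟨
      b * (1 * count U)        ≤⟨ *-monoʳ-≤ b (≤-trans (*-monoˡ-≤ (count U) (m≤n+m 1 (i * g))) h) ⟩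
      b * (b * count W)        ≡⟨ *-assoc b b _ ⟨
      b * b * count W ∎)
      where open ≤-Reasoning
    extend : ∀ i → (i * g + 1) * count U ≤ b * count W → ∀ x → W x ≡ true →
      manyᵗ (b * b) i (λ w → W x ∧ cliqueIn e (λ y → W y ∧ e x y) w) ≡ true
    extend zero    h x Wx = ∧-intro Wx refl
    extend (suc i) h x Wx = manyᵗ-mono (suc i) {A = cliqueIn e (λ y → W y ∧ e x y)} ≤-refl (λ w p → ∧-intro Wx p)
      (greedy b g U n≤bu high i (λ y → W y ∧ e x y) (λ y p → W⊆U y (proj₁ (∧-elim p)))
        (arith i g (count U) (count W) (count (λ y → W y ∧ e x y)) (degIn U x) h (high x (W⊆U x Wx)) common))
      where
      pt : ∀ y → ⟦ W y ⟧ + ⟦ U y ∧ e x y ⟧ ≤ ⟦ W y ∧ e x y ⟧ + ⟦ U y ⟧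
      pt y with W y | U y | e x y | W⊆U y
      ... | true  | true  | true  | _ = ≤-refl
      ... | true  | true  | false | _ = ≤-refl
      ... | true  | false | _     | f = contradiction (f refl) λ ()
      ... | false | true  | true  | _ = ≤-refl
      ... | false | true  | false | _ = z≤n
      ... | false | false | _     | _ = z≤n
      common : count W + degIn U x ≤ count (λ y → W y ∧ e x y) + count U
      common = begin
        count W + degIn U x                       ≡⟨ sum-+ (λ y → ⟦ W y ⟧) (λ y → ⟦ U y ∧ e x y ⟧) ⟨
        sum (λ y → ⟦ W y ⟧ + ⟦ U y ∧ e x y ⟧)     ≤⟨ sum-mono pt ⟩
        sum (λ y → ⟦ W y ∧ e x y ⟧ + ⟦ U y ⟧)     ≡⟨ sum-+ (λ y → ⟦ W y ∧ e x y ⟧) (λ y → ⟦ U y ⟧) ⟩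
        count (λ y → W y ∧ e x y) + count U ∎
        where open ≤-Reasoning
      arith : ∀ i g u W W' d → (suc i * g + 1) * u ≤ b * W → b * u ≤ b * d + g * u → W + d ≤ W' + u →
        (i * g + 1) * u ≤ b * W'
      arith i g u W W' d h₁ h₂ h₃ = ≤-transfer (+-mono-≤ (+-mono-≤ h₁ h₂) (*-monoʳ-≤ b h₃)) (≤-reflexive (eq b i g u W W' d))
        where
        eq : ∀ b i g u W W' d → (i * g + 1) * u + (b * W + (b * d + g * u) + b * (W' + u))
           ≡ b * W' + ((suc i * g + 1) * u + b * u + b * (W + d))
        eq = solve-∀

  -- Turán's theorem with supersaturation. With r = r' + 1, q = q' + 1 and m = count M,
  -- the hypothesis reads inside M ≥ (1 - 1/r) m² + n² / q.
  turán : ∀ r' q' (M : Fin n → Bool) → 3 * r' * suc q' + 1 ≤ n →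
    r' * suc q' * (count M * count M) + suc r' * (n * n) ≤ suc r' * suc q' * inside M →
    manyᵗ (3 * (suc r' * suc q') * (3 * (suc r' * suc q'))) (suc (suc r')) (cliqueIn e M) ≡ true
  turán r' q' M a≤n H with clean a b (count M) M ≤-refl start
    where
    -- a / b exceeds 1 - 1/r by 1/(3rq), and g = b - a = 3q - 1 bounds the loss per chosen vertex.
    -- Since b - rg = r ≥ 1, candidates remain after r choices, so an (r + 1)-st vertex exists. The
    -- factor 3 provides three copies of n² to pay for m², for am (by a ≤ n) and for the n² that
    -- `clean` keeps.
    a = 3 * r' * suc q' + 1
    b = 3 * (suc r' * suc q')
    arith : ∀ r' q m n D → m ≤ n → 3 * r' * q + 1 ≤ n →
      r' * q * (m * m) + suc r' * (n * n) ≤ suc r' * q * D →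
      (3 * r' * q + 1) * (m * (m + 1)) + n * n ≤ 3 * (suc r' * q) * D
    arith r' q m n D m≤n a≤n h = ≤-transfer
      (+-mono-≤ (*-monoʳ-≤ 3 h) (+-mono-≤ (*-mono-≤ m≤n m≤n) (*-mono-≤ a≤n m≤n)))
      (≤-trans (m≤m+n _ (3 * r' * (n * n))) (≤-reflexive (eq r' q m n D)))
      where
      eq : ∀ r' q m n D → (3 * r' * q + 1) * (m * (m + 1)) + n * n + (3 * (suc r' * q * D) + (n * n + n * n)) + 3 * r' * (n * n)
         ≡ 3 * (suc r' * q) * D + (3 * (r' * q * (m * m) + suc r' * (n * n)) + (m * m + (3 * r' * q + 1) * m))
      eq = solve-∀
    start : a * (count M * (count M + 1)) + n * n ≤ b * inside M
    start = arith r' (suc q') (count M) n (inside M) (count≤n M) a≤n H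
  ... | U , U⊆M , high , big = manyᵗ-mono (suc (suc r')) ≤-refl (cliqueIn-mono e U⊆M)
      (greedy b g U n≤bu high' (suc r') U (λ _ p → p) (≤-trans (m≤m+n _ (r' * count U)) (≤-reflexive (eq₂ r' q' (count U)))))
    where
    g = 3 * q' + 2
    b = 3 * (suc r' * suc q')
    eq₂ : ∀ r' q' u → (suc r' * (3 * q' + 2) + 1) * u + r' * u ≡ 3 * (suc r' * suc q') * u
    eq₂ = solve-∀
    eq₁ : ∀ r' q' u → 3 * (suc r' * suc q') * u ≡ (3 * r' * suc q' + 1) * u + (3 * q' + 2) * u
    eq₁ = solve-∀
    high' : ∀ v → U v ≡ true → b * count U ≤ b * degIn U v + g * count U
    high' v Uv = ≤-trans (≤-reflexive (eq₁ r' q' (count U))) (+-monoˡ-≤ (g * count U) (high v Uv))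
    inside≤ : inside U ≤ count U * count U
    inside≤ = ≤-trans (sum²-mono (λ x y → ⟦⟧-mono (λ h → let (p , q) = ∧-elim {U x} h in ∧-intro p (proj₁ (∧-elim {U y} q)))))
                      (≤-reflexive (pairs-∧ U U))
    n≤bu : n ≤ b * count U
    n≤bu with n ≤? b * count U
    ... | yes p = p
    ... | no ¬p = contradiction (≤-trans big (≤-trans (*-monoʳ-≤ b inside≤) (≤-trans (m≤n*m _ b) (≤-reflexive (eq₃ b (count U))))))
                    (λ q → n≮n _ (<-≤-trans (*-mono-< (≰⇒> ¬p) (≰⇒> ¬p)) q))
      where
      eq₃ : ∀ b u → b * (b * (u * u)) ≡ b * u * (b * u)
      eq₃ = solve-∀

  -- Densities that force the four patterns

  module _ (M : Fin n → Bool) where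

    -- Inclusion-exclusion for the edges and the pairs of marked vertices among all n² ordered
    -- pairs.
    pairs≤inside : pairs e + count M * count M ≤ inside M + n * n
    pairs≤inside = begin
      pairs e + count M * count M                             ≡⟨ cong (λ z → pairs e + z) (pairs-∧ M M) ⟨
      pairs e + pairs (λ u v → M u ∧ M v)                      ≡⟨ sum²-+ (λ u v → ⟦ e u v ⟧) (λ u v → ⟦ M u ∧ M v ⟧) ⟨
      sum² (λ u v → ⟦ e u v ⟧ + ⟦ M u ∧ M v ⟧)                 ≤⟨ sum²-mono (λ u v → pt (M u) (M v) (e u v)) ⟩
      sum² (λ u v → ⟦ M u ∧ (M v ∧ e u v) ⟧ + 1)               ≡⟨ sum²-+ (λ u v → ⟦ M u ∧ (M v ∧ e u v) ⟧) (λ _ _ → 1) ⟩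
      inside M + sum² {n} {n} (λ _ _ → 1)                     ≡⟨ cong (λ z → inside M + z) (trans (sum-cong-≗ {n} (λ _ → trans (sum-const n 1) (*-identityʳ n))) (sum-const n n)) ⟩
      inside M + n * n ∎
      where
      open ≤-Reasoning
      pt : ∀ a b c → ⟦ c ⟧ + ⟦ a ∧ b ⟧ ≤ ⟦ a ∧ (b ∧ c) ⟧ + 1
      pt true  true  true  = ≤-refl
      pt true  true  false = ≤-refl
      pt true  false true  = ≤-refl
      pt true  false false = z≤n
      pt false b     true  = ≤-refl
      pt false b     false = z≤n

    -- With R = 2 + r, the bound on `inside M` beats the Turán threshold by a multiple of (n - m)((R
    -- - 1)n - m). This is nonnegative because R ≥ 2; for R = 1 it would be -(n - m)m, so the
    -- bipartite case needs the larger constant 5/4.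
    many-cliques : ∀ r q' → 3 * (suc r) * suc q' + 1 ≤ n →
      ((3 + 2 * r) * suc q' + (2 + r)) * (n * n) ≤ (2 + r) * suc q' * (count M * n + pairs e) →
      manyᵗ (3 * ((2 + r) * suc q') * (3 * ((2 + r) * suc q'))) (3 + r) (cliqueIn e M) ≡ true
    many-cliques r q' a≤n h = turán (suc r) q' M a≤n
      (arith r (suc q') (count M) (count (not ∘ M)) (pairs e) (inside M) (count-not M) h pairs≤inside)
      where
      arith : ∀ {n} r q m c S D → m + c ≡ n →
        ((3 + 2 * r) * q + (2 + r)) * (n * n) ≤ (2 + r) * q * (m * n + S) → S + m * m ≤ D + n * n →
        suc r * q * (m * m) + (2 + r) * (n * n) ≤ (2 + r) * q * D
      arith r q m c S D refl h₁ h₂ = ≤-transfer (+-mono-≤ h₁ (*-monoʳ-≤ ((2 + r) * q) h₂))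
        (≤-trans (m≤m+n _ (q * (c * (r * (m + c) + c)))) (≤-reflexive (eq r q m c S D)))
        where
        eq : ∀ r q m c S D → suc r * q * (m * m) + (2 + r) * ((m + c) * (m + c)) + ((2 + r) * q * (m * (m + c) + S) + (2 + r) * q * (D + (m + c) * (m + c))) + q * (c * (r * (m + c) + c))
           ≡ (2 + r) * q * D + (((3 + 2 * r) * q + (2 + r)) * ((m + c) * (m + c)) + (2 + r) * q * (S + m * m))
        eq = solve-∀

    -- Turán with r = 1 asks only for a positive density of edges among marked vertices. The slack
    -- is (n - 2m)²/4, which vanishes when exactly half of the vertices are marked.
    many-marked-edges : ∀ q' → 1 ≤ n →
      (5 * suc q' + 4) * (n * n) ≤ 4 * suc q' * (count M * n + pairs e) →
      manyᵗ (3 * (1 * suc q') * (3 * (1 * suc q'))) 2 (cliqueIn e M) ≡ true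
    many-marked-edges q' 1≤n h = turán 0 q' M 1≤n
      (arith (suc q') (count M) (count (not ∘ M)) (pairs e) (inside M) (count-not M) h pairs≤inside)
      where
      arith : ∀ {n} q m c S D → m + c ≡ n →
        (5 * q + 4) * (n * n) ≤ 4 * q * (m * n + S) → S + m * m ≤ D + n * n →
        0 * q * (m * m) + 1 * (n * n) ≤ 1 * q * D
      arith q m c S D refl h₁ h₂ = *-cancelˡ-≤ 4 (≤-transfer
        (+-mono-≤ (+-mono-≤ h₁ (*-monoʳ-≤ (4 * q) h₂)) (*-monoʳ-≤ q (2xy≤x²+y² m c)))
        (≤-reflexive (eq q m c S D)))
        where
        eq : ∀ q m c S D → 4 * (0 * q * (m * m) + 1 * ((m + c) * (m + c))) + (4 * q * (m * (m + c) + S) + 4 * q * (D + (m + c) * (m + c)) + q * (m * m + c * c))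
           ≡ 4 * (1 * q * D) + ((5 * q + 4) * ((m + c) * (m + c)) + 4 * q * (S + m * m) + q * (2 * (m * c)))
        eq = solve-∀

    -- With c unmarked vertices, at most c² ordered edges avoid the marked ones, and mn + c² ≤ n².
    -- All of the excess n²/q therefore comes from edges with a marked end.
    many-half-marked-edges : ∀ q →
      (q + 1) * (n * n) ≤ q * (count M * n + pairs e) →
      manyᵗ (2 * (2 * q)) 2 (edge-pattern M e) ≡ true
    many-half-marked-edges q h = dense⇒many (2 * q) half
      (arith q (count M) (count (not ∘ M)) (pairs half) (pairs e) (count-not M) bound h)
      where
      half : Fin n → Fin n → Bool
      half u v = M u ∧ e u v
      pt : ∀ a b {c d} → (c ≡ true → d ≡ true) → ⟦ c ⟧ ≤ ⟦ a ∧ c ⟧ + ⟦ b ∧ d ⟧ + ⟦ not a ∧ not b ⟧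
      pt a     b     {false} f = z≤n
      pt true  b     {true}  f = s≤s z≤n
      pt false true  {true}  f rewrite f refl = s≤s z≤n
      pt false false {true}  f = s≤s z≤n
      bound : pairs e ≤ pairs half + pairs half + count (not ∘ M) * count (not ∘ M)
      bound = begin
        pairs e
          ≤⟨ sum²-mono (λ u v → pt (M u) (M v) (e-sym u v)) ⟩
        sum² (λ u v → ⟦ half u v ⟧ + ⟦ half v u ⟧ + ⟦ not (M u) ∧ not (M v) ⟧)
          ≡⟨ sum²-+ (λ u v → ⟦ half u v ⟧ + ⟦ half v u ⟧) (λ u v → ⟦ not (M u) ∧ not (M v) ⟧) ⟩
        sum² (λ u v → ⟦ half u v ⟧ + ⟦ half v u ⟧) + pairs (λ u v → not (M u) ∧ not (M v))
          ≡⟨ cong₂ _+_ (trans (sum²-+ (λ u v → ⟦ half u v ⟧) (λ u v → ⟦ half v u ⟧)) (cong (λ z → pairs half + z) (∑-comm (λ u v → ⟦ half v u ⟧)))) (pairs-∧ (not ∘ M) (not ∘ M)) ⟩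
        pairs half + pairs half + count (not ∘ M) * count (not ∘ M) ∎
        where open ≤-Reasoning
      arith : ∀ {n} q m c D S → m + c ≡ n → S ≤ D + D + c * c → (q + 1) * (n * n) ≤ q * (m * n + S) →
        n * n ≤ 2 * q * D
      arith q m c D S refl h₁ h₂ = ≤-transfer (≤-trans h₂ (*-monoʳ-≤ q (+-monoʳ-≤ _ h₁)))
        (≤-trans (m≤m+n _ (q * (m * c))) (≤-reflexive (eq q m c D)))
        where
        eq : ∀ q m c D → (m + c) * (m + c) + q * (m * (m + c) + (D + D + c * c)) + q * (m * c)
           ≡ 2 * q * D + (q + 1) * ((m + c) * (m + c))
        eq = solve-∀

    -- Edges between a marked vertex and a vertex outside B number o(n²). If also few edges lie inside B,
    -- nearly all edges join B \ M to its complement or lie in the complement Z of M ∪ B,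
    -- so (with densities m + b + c = 1) h is at most m + 2b(m + c) + c² ≤ 9/8.
    many-P₄ : ∀ q →
      (9 * q + 8) * (n * n) ≤ 8 * q * (count M * n + pairs e) →
      manyᵗ (2 * (2 * q)) 4 (P₄-pattern M e) ≡ true
    many-P₄ q h = many-mono ≤-refl (λ u → many-mono ≤-refl (λ v → pick u v)) (dense⇒many (2 * q) mid
      (arith q (count M) (count B') (count Z) (pairs e) (pairs bad) (pairs mid) partition h badFew bound))
      where
      -- A vertex outside B has at most n/K marked neighbours, so `bad` in its two orders costs at
      -- most 2n²/K = n²/(2q), half of the excess n²/q. The other half is left for `mid`, and
      -- `dense⇒many` applied to it returns this same K.
      K = 2 * (2 * q)
      B B' Z : Fin n → Bool
      B v = many K (λ x → M x ∧ e v x)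
      B' v = not (M v) ∧ B v
      Z v = not (M v) ∧ not (B v)
      bad mid : Fin n → Fin n → Bool
      bad u v = not (B u) ∧ (M v ∧ e u v)
      mid u v = B u ∧ (B v ∧ e u v)
      pick : ∀ u v → mid u v ≡ true → manyᵗ K 2 (λ w → P₄-pattern M e (u ∷ v ∷ w)) ≡ true
      pick u v p =
        let (Bu , q') = ∧-elim {B u} p ; (Bv , uv) = ∧-elim {B v} q'
        in many-mono ≤-refl (λ x hx → many-mono ≤-refl (λ y hy → ∧-intro hx (∧-intro hy uv)) Bv) Bu
      partition : count M + (count B' + count Z) ≡ n
      partition = trans (cong (λ z → count M + z) (trans (sym (sum-+ (λ v → ⟦ B' v ⟧) (λ v → ⟦ Z v ⟧))) (sum-cong-≗ {x = λ v → ⟦ B' v ⟧ + ⟦ Z v ⟧} (λ v → split (M v) (B v))))) (count-not M)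
        where
        split : ∀ a b → ⟦ not a ∧ b ⟧ + ⟦ not a ∧ not b ⟧ ≡ ⟦ not a ⟧
        split true  b     = refl
        split false true  = refl
        split false false = refl
      badFew : K * pairs bad ≤ n * n
      badFew = begin
        K * pairs bad                    ≡⟨ sum-scale K (λ u → count (bad u)) ⟨
        sum (λ u → K * count (bad u))    ≤⟨ sum-mono row ⟩
        sum {n} (λ _ → n)                ≡⟨ sum-const n n ⟩
        n * n ∎
        where
        open ≤-Reasoning
        row : ∀ u → K * count (bad u) ≤ n
        row u with B u in eq
        ... | true  = ≤-trans (≤-reflexive (trans (cong (K *_) (trans (sum-const n 0) (*-zeroʳ n))) (*-zeroʳ K))) z≤n
        ... | false = ¬many K (λ x → M x ∧ e u x) eq
      -- The products omit the pairs M-M, M-Z and B'-B'. Edges there are `bad` in one of the two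
      -- orders or `mid`.
      pt : ∀ mu mv bu bv {c d} → (c ≡ true → d ≡ true) →
        ⟦ c ⟧ ≤ ⟦ not bu ∧ (mv ∧ c) ⟧ + ⟦ not bv ∧ (mu ∧ d) ⟧ + ⟦ bu ∧ (bv ∧ c) ⟧
              + (⟦ (not mu ∧ bu) ∧ mv ⟧ + ⟦ mu ∧ (not mv ∧ bv) ⟧)
              + (⟦ (not mu ∧ bu) ∧ (not mv ∧ not bv) ⟧ + ⟦ (not mu ∧ not bu) ∧ (not mv ∧ bv) ⟧)
              + ⟦ (not mu ∧ not bu) ∧ (not mv ∧ not bv) ⟧
      pt mu mv bu bv {false} f = z≤n
      pt mu mv bu bv {true} f rewrite f refl = cases mu mv bu bv
        where
        cases : ∀ mu mv bu bv →
          1 ≤ ⟦ not bu ∧ (mv ∧ true) ⟧ + ⟦ not bv ∧ (mu ∧ true) ⟧ + ⟦ bu ∧ (bv ∧ true) ⟧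
              + (⟦ (not mu ∧ bu) ∧ mv ⟧ + ⟦ mu ∧ (not mv ∧ bv) ⟧)
              + (⟦ (not mu ∧ bu) ∧ (not mv ∧ not bv) ⟧ + ⟦ (not mu ∧ not bu) ∧ (not mv ∧ bv) ⟧)
              + ⟦ (not mu ∧ not bu) ∧ (not mv ∧ not bv) ⟧
        cases true  true  true  true  = s≤s z≤n
        cases true  true  true  false = s≤s z≤n
        cases true  true  false true  = s≤s z≤n
        cases true  true  false false = s≤s z≤n
        cases true  false true  true  = s≤s z≤n
        cases true  false true  false = s≤s z≤n
        cases true  false false true  = s≤s z≤n
        cases true  false false false = s≤s z≤n
        cases false true  true  true  = s≤s z≤n
        cases false true  true  false = s≤s z≤n
        cases false true  false true  = s≤s z≤n
        cases false true  false false = s≤s z≤n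
        cases false false true  true  = s≤s z≤n
        cases false false true  false = s≤s z≤n
        cases false false false true  = s≤s z≤n
        cases false false false false = s≤s z≤n
      bound : pairs e ≤ pairs bad + pairs bad + pairs mid + (count B' * count M + count M * count B')
                + (count B' * count Z + count Z * count B') + count Z * count Z
      bound = begin
        pairs e
          ≤⟨ sum²-mono (λ u v → pt (M u) (M v) (B u) (B v) (e-sym u v)) ⟩
        sum² (λ u v → f₁ u v + f₂ u v + f₃ u v + (f₄ u v + f₅ u v) + (f₆ u v + f₇ u v) + f₈ u v)
          ≡⟨ sum²-+ (λ u v → f₁ u v + f₂ u v + f₃ u v + (f₄ u v + f₅ u v) + (f₆ u v + f₇ u v)) f₈ ⟩
        sum² (λ u v → f₁ u v + f₂ u v + f₃ u v + (f₄ u v + f₅ u v) + (f₆ u v + f₇ u v)) + sum² f₈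
          ≡⟨ cong₂ _+_ (trans (sum²-+ (λ u v → f₁ u v + f₂ u v + f₃ u v + (f₄ u v + f₅ u v)) (λ u v → f₆ u v + f₇ u v))
               (cong₂ _+_ (trans (sum²-+ (λ u v → f₁ u v + f₂ u v + f₃ u v) (λ u v → f₄ u v + f₅ u v))
                 (cong₂ _+_ (trans (sum²-+ (λ u v → f₁ u v + f₂ u v) f₃)
                   (cong (_+ sum² f₃) (trans (sum²-+ f₁ f₂) (cong (λ z → sum² f₁ + z) (∑-comm f₂)))))
                   (trans (sum²-+ f₄ f₅) (cong₂ _+_ (pairs-∧ B' M) (pairs-∧ M B')))))
                 (trans (sum²-+ f₆ f₇) (cong₂ _+_ (pairs-∧ B' Z) (pairs-∧ Z B'))))) (pairs-∧ Z Z) ⟩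
        pairs bad + pairs bad + pairs mid + (count B' * count M + count M * count B')
                + (count B' * count Z + count Z * count B') + count Z * count Z ∎
        where
        open ≤-Reasoning
        f₁ f₂ f₃ f₄ f₅ f₆ f₇ f₈ : Fin n → Fin n → ℕ
        f₁ u v = ⟦ bad u v ⟧
        f₂ u v = ⟦ bad v u ⟧
        f₃ u v = ⟦ mid u v ⟧
        f₄ u v = ⟦ B' u ∧ M v ⟧
        f₅ u v = ⟦ M u ∧ B' v ⟧
        f₆ u v = ⟦ B' u ∧ Z v ⟧
        f₇ u v = ⟦ Z u ∧ B' v ⟧
        f₈ u v = ⟦ Z u ∧ Z v ⟧
      arith : ∀ {n} q m b c S X D → m + (b + c) ≡ n →
        (9 * q + 8) * (n * n) ≤ 8 * q * (m * n + S) → 2 * (2 * q) * X ≤ n * n →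
        S ≤ X + X + D + (b * m + m * b) + (b * c + c * b) + c * c →
        n * n ≤ 2 * q * D
      -- The square (m - 3b)² ≥ 0 is tight at m = 3b, and the remaining slack vanishes at c = 0:
      -- this is the extremal configuration with 3/4 of the vertices marked.
      arith q m b c S X D refl h₁ h₂ h₃ = *-cancelˡ-≤ 4 (≤-transfer
        (+-mono-≤ (+-mono-≤ (≤-trans h₁ (*-monoʳ-≤ (8 * q) (+-monoʳ-≤ _ h₃))) (*-monoʳ-≤ 4 h₂)) (*-monoʳ-≤ q (2xy≤x²+y² m (3 * b))))
        (≤-trans (m≤m+n _ (q * (c * c + 10 * (m * c) + 2 * (b * c)))) (≤-reflexive (eq q m b c X D))))
        where
        eq : ∀ q m b c X D → 4 * ((m + (b + c)) * (m + (b + c)))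
             + (8 * q * (m * (m + (b + c)) + (X + X + D + (b * m + m * b) + (b * c + c * b) + c * c)) + 4 * ((m + (b + c)) * (m + (b + c))) + q * (m * m + 3 * b * (3 * b)))
             + q * (c * c + 10 * (m * c) + 2 * (b * c))
           ≡ 4 * (2 * q * D) + ((9 * q + 8) * ((m + (b + c)) * (m + (b + c))) + 4 * (2 * (2 * q) * X) + q * (2 * (m * (3 * b))))
        eq = solve-∀

-- The value of h

size0⇒∅ : ∀ {n} (A : Subset n) → size A ≡ 0 → A ≡ ∅
size0⇒∅ []          _ = refl
size0⇒∅ (false ∷ A) h = cong (false ∷_) (size0⇒∅ A h)

size1⇒singleton : ∀ {n} (A : Subset n) → size A ≡ 1 → ∃ λ i → A ≡ ⁅ i ⁆
size1⇒singleton (true ∷ A)  h = zero , cong (true ∷_) (size0⇒∅ A (suc-injective h))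
size1⇒singleton (false ∷ A) h with size1⇒singleton A h
... | i , refl = suc i , refl

size2⇒pair : ∀ {n} (A : Subset n) → size A ≡ 2 → ∃₂ λ i j → i ≢ j × A ≡ ⁅ i ⁆ ∪ ⁅ j ⁆
size2⇒pair (true ∷ A) h with size1⇒singleton A (suc-injective h)
... | j , refl = zero , suc j , (λ ()) , cong (true ∷_) (sym (∪-identityˡ ⁅ j ⁆))
size2⇒pair (false ∷ A) h with size2⇒pair A h
... | i , j , i≢j , refl = suc i , suc j , i≢j ∘ FP.suc-injective , refl

size-pair : ∀ {n} {i j : Fin n} → i ≢ j → size (⁅ i ⁆ ∪ ⁅ j ⁆) ≡ 2
size-pair {i = zero}  {zero}  i≢j = contradiction refl i≢j
size-pair {i = zero}  {suc j} _   = cong suc (trans (cong size (∪-identityˡ ⁅ j ⁆)) (∣⁅x⁆∣≡1 j))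
size-pair {i = suc i} {zero}  _   = cong suc (trans (cong size (∪-identityʳ ⁅ i ⁆)) (∣⁅x⁆∣≡1 i))
size-pair {i = suc i} {suc j} i≢j = size-pair (i≢j ∘ cong suc)

∈pair⁻ : ∀ {n} {x i j : Fin n} → x ∈ ⁅ i ⁆ ∪ ⁅ j ⁆ → x ≡ i ⊎ x ≡ j
∈pair⁻ {i = i} {j} h with x∈p∪q⁻ ⁅ i ⁆ ⁅ j ⁆ h
... | inj₁ p = inj₁ (x∈⁅y⁆⇒x≡y i p)
... | inj₂ p = inj₂ (x∈⁅y⁆⇒x≡y j p)

∈pairˡ : ∀ {n} (i j : Fin n) → i ∈ ⁅ i ⁆ ∪ ⁅ j ⁆
∈pairˡ i j = x∈p∪q⁺ (inj₁ (x∈⁅x⁆ i))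

∈pairʳ : ∀ {n} (i j : Fin n) → j ∈ ⁅ i ⁆ ∪ ⁅ j ⁆
∈pairʳ i j = x∈p∪q⁺ (inj₂ (x∈⁅x⁆ j))

singleton-injective : ∀ {n} {i j : Fin n} → ⁅ i ⁆ ≡ ⁅ j ⁆ → i ≡ j
singleton-injective {i = i} {j} eq = x∈⁅y⁆⇒x≡y j (subst (i ∈_) eq (x∈⁅x⁆ i))

pair-injective : ∀ {n} {i j a b : Fin n} → i ≢ j → ⁅ i ⁆ ∪ ⁅ j ⁆ ≡ ⁅ a ⁆ ∪ ⁅ b ⁆ →
  (i ≡ a × j ≡ b) ⊎ (i ≡ b × j ≡ a)
pair-injective {i = i} {j} i≢j eq with ∈pair⁻ (subst (i ∈_) eq (∈pairˡ i j)) | ∈pair⁻ (subst (j ∈_) eq (∈pairʳ i j))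
... | inj₁ p | inj₁ q = contradiction (trans p (sym q)) i≢j
... | inj₁ p | inj₂ q = inj₁ (p , q)
... | inj₂ p | inj₁ q = inj₂ (p , q)
... | inj₂ p | inj₂ q = contradiction (trans p (sym q)) i≢j

∈image⁻ : ∀ {m n} (f : Fin m → Fin n) (A : Subset m) {x} → x ∈ image f A → ∃ λ i → i ∈ A × f i ≡ x
∈image⁻ f A {x} h = dec-true⁻ {d = any? (λ i → (i ∈? A) ×-dec (f i F.≟ x))} (trans (sym (lookup∘tabulate _ x)) ([]=⇒lookup h))

∈image⁺ : ∀ {m n} (f : Fin m → Fin n) (A : Subset m) {i} → i ∈ A → f i ∈ image f A
∈image⁺ f A {i} i∈A = lookup⇒[]= (f i) _ (trans (lookup∘tabulate _ (f i)) (dec-true⁺ {d = any? (λ k → (k ∈? A) ×-dec (f k F.≟ f i))} (i , i∈A , refl)))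

image-singleton : ∀ {m n} (f : Fin m → Fin n) i → image f ⁅ i ⁆ ≡ ⁅ f i ⁆
image-singleton f i = ⊆-antisym to from
  where
  to : ∀ {x} → x ∈ image f ⁅ i ⁆ → x ∈ ⁅ f i ⁆
  to h with ∈image⁻ f ⁅ i ⁆ h
  ... | k , k∈ , refl rewrite x∈⁅y⁆⇒x≡y i k∈ = x∈⁅x⁆ (f i)
  from : ∀ {x} → x ∈ ⁅ f i ⁆ → x ∈ image f ⁅ i ⁆
  from h rewrite x∈⁅y⁆⇒x≡y (f i) h = ∈image⁺ f ⁅ i ⁆ (x∈⁅x⁆ i)

image-pair : ∀ {m n} (f : Fin m → Fin n) i j → image f (⁅ i ⁆ ∪ ⁅ j ⁆) ≡ ⁅ f i ⁆ ∪ ⁅ f j ⁆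
image-pair f i j = ⊆-antisym to from
  where
  to : ∀ {x} → x ∈ image f (⁅ i ⁆ ∪ ⁅ j ⁆) → x ∈ ⁅ f i ⁆ ∪ ⁅ f j ⁆
  to h with ∈image⁻ f (⁅ i ⁆ ∪ ⁅ j ⁆) h
  ... | k , k∈ , refl with ∈pair⁻ k∈
  ... | inj₁ refl = ∈pairˡ (f i) (f j)
  ... | inj₂ refl = ∈pairʳ (f i) (f j)
  from : ∀ {x} → x ∈ ⁅ f i ⁆ ∪ ⁅ f j ⁆ → x ∈ image f (⁅ i ⁆ ∪ ⁅ j ⁆)
  from h with ∈pair⁻ h
  ... | inj₁ refl = ∈image⁺ f _ (∈pairˡ i j)
  ... | inj₂ refl = ∈image⁺ f _ (∈pairʳ i j)

-- Hypergraphs with edge sizes 1 and 2 as graphs with marked vertices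

mark : (G : Hypergraph) → Fin (v G) → Bool
mark G i = E G ⁅ i ⁆

adj : (G : Hypergraph) → Fin (v G) → Fin (v G) → Bool
adj G i j = not ⌊ i F.≟ j ⌋ ∧ E G (⁅ i ⁆ ∪ ⁅ j ⁆)

Adj2⇒adj : ∀ G {i j} → Adj2 G i j → adj G i j ≡ true
Adj2⇒adj G {i} {j} (i≢j , h) with i F.≟ j
... | yes p = contradiction p i≢j
... | no _  = h

adj⇒Adj2 : ∀ G {i j} → adj G i j ≡ true → Adj2 G i j
adj⇒Adj2 G {i} {j} h with i F.≟ j
... | no i≢j = i≢j , h

Adj2-sym : ∀ G {i j} → Adj2 G i j → Adj2 G j i
Adj2-sym G {i} {j} (i≢j , h) = i≢j ∘ sym , trans (cong (E G) (∪-comm ⁅ j ⁆ ⁅ i ⁆)) h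

adj-sym : ∀ G i j → adj G i j ≡ true → adj G j i ≡ true
adj-sym G i j h = Adj2⇒adj G (Adj2-sym G (adj⇒Adj2 G h))

Sizes12 : Hypergraph → Set
Sizes12 G = ∀ A → IsEdge G A → size A ≡ 1 ⊎ size A ≡ 2

RSub⇒Sizes12 : ∀ G H → Sizes12 H → RSub G H → Sizes12 G
RSub⇒Sizes12 G H sizes sub A A∈E with sub A A∈E
... | B , B∈E , eq with sizes B B∈E
... | inj₁ p = inj₁ (trans eq p)
... | inj₂ p = inj₂ (trans eq p)

Sizes12⇒RSub : ∀ G H → R≡12 H → Sizes12 G → RSub G H
Sizes12⇒RSub G H (_ , (A₁ , E₁ , s₁) , (A₂ , E₂ , s₂)) sizes A A∈E with sizes A A∈E
... | inj₁ p = A₁ , E₁ , trans p (sym s₁)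
... | inj₂ p = A₂ , E₂ , trans p (sym s₂)

record Hom (H G : Hypergraph) : Set where
  constructor hom
  field
    fn    : Fin (v H) → Fin (v G)
    injective : Injective _≡_ _≡_ fn
    marks : ∀ i → mark H i ≡ true → mark G (fn i) ≡ true
    edges : ∀ i j → Adj2 H i j → Adj2 G (fn i) (fn j)

Hom⇒⊆H : ∀ H G → Sizes12 H → Hom H G → H ⊆H G
Hom⇒⊆H H G sizes (hom f inj marks edges) = f , inj , go
  where
  go : ∀ A → IsEdge H A → IsEdge G (image f A)
  go A A∈E with sizes A A∈E
  ... | inj₁ p with size1⇒singleton A p
  ... | i , refl = trans (cong (E G) (image-singleton f i)) (marks i A∈E)
  go A A∈E | inj₂ p with size2⇒pair A p
  ... | i , j , i≢j , refl = trans (cong (E G) (image-pair f i j)) (proj₂ (edges i j (i≢j , A∈E)))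

⊆H⇒Hom : ∀ H G → H ⊆H G → Hom H G
⊆H⇒Hom H G (f , inj , h) = hom f inj
  (λ i m → trans (cong (E G) (sym (image-singleton f i))) (h ⁅ i ⁆ m))
  (λ i j (i≢j , e) → i≢j ∘ inj , trans (cong (E G) (sym (image-pair f i j))) (h _ e))

sumSubsetsℕ : ∀ n → (Subset n → ℕ) → ℕ
sumSubsetsℕ zero    f = f []
sumSubsetsℕ (suc n) f = sumSubsetsℕ n (f ∘ (false ∷_)) + sumSubsetsℕ n (f ∘ (true ∷_))

sumSubsetsℕ-linear : ∀ n c d (f g : Subset n → ℕ) →
  sumSubsetsℕ n (λ A → c * f A + d * g A) ≡ c * sumSubsetsℕ n f + d * sumSubsetsℕ n g
sumSubsetsℕ-linear zero    c d f g = refl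
sumSubsetsℕ-linear (suc n) c d f g = trans
  (cong₂ _+_ (sumSubsetsℕ-linear n c d (f ∘ (false ∷_)) (g ∘ (false ∷_))) (sumSubsetsℕ-linear n c d (f ∘ (true ∷_)) (g ∘ (true ∷_))))
  (eq c d (sumSubsetsℕ n (f ∘ (false ∷_))) _ _ _)
  where
  eq : ∀ c d a b x y → c * a + d * b + (c * x + d * y) ≡ c * (a + x) + d * (b + y)
  eq = solve-∀

level : ∀ n → ℕ → (Subset n → ℕ) → ℕ
level n j e = sumSubsetsℕ n (λ A → if size A ≡ᵇ j then e A else 0)

sumSubsetsℕ-zero : ∀ n → sumSubsetsℕ n (λ _ → 0) ≡ 0
sumSubsetsℕ-zero zero    = refl
sumSubsetsℕ-zero (suc n) = cong₂ _+_ (sumSubsetsℕ-zero n) (sumSubsetsℕ-zero n)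

level-0 : ∀ n e → level n 0 e ≡ e ∅
level-0 zero    e = refl
level-0 (suc n) e = trans (cong₂ _+_ (level-0 n (e ∘ (false ∷_))) (sumSubsetsℕ-zero n)) (+-identityʳ _)

level-1 : ∀ n e → level n 1 e ≡ sum (λ i → e ⁅ i ⁆)
level-1 zero    e = refl
level-1 (suc n) e = trans (cong₂ _+_ (level-1 n (e ∘ (false ∷_))) (level-0 n (e ∘ (true ∷_)))) (+-comm _ (e ⁅ zero ⁆))

offDiagonal : ∀ {n} → (Fin n → Fin n → ℕ) → Fin n → Fin n → ℕ
offDiagonal f i j = if ⌊ i F.≟ j ⌋ then 0 else f i j

-- The factor 2 passes to ordered pairs. In the induction the 2-sets through the new vertex form its
-- row and its column, each a copy of level 1; the diagonal is excluded since ⁅ i ⁆ ∪ ⁅ i ⁆ is a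
-- singleton.
level-2 : ∀ n e → 2 * level n 2 e ≡ sum² (offDiagonal {n} (λ i j → e (⁅ i ⁆ ∪ ⁅ j ⁆)))
level-2 zero    e = refl
level-2 (suc n) e = begin
  2 * (level n 2 e₀ + level n 1 e₁)
    ≡⟨ eq₁ (level n 2 e₀) (level n 1 e₁) ⟩
  level n 1 e₁ + (level n 1 e₁ + 2 * level n 2 e₀)
    ≡⟨ cong₂ (λ a b → a + (a + b)) (level-1 n e₁) (level-2 n e₀) ⟩
  sum (λ i → e₁ ⁅ i ⁆) + (sum (λ i → e₁ ⁅ i ⁆) + sum² (offDiagonal (λ i j → e₀ (⁅ i ⁆ ∪ ⁅ j ⁆))))
    ≡⟨ cong (λ z → sum (λ i → e₁ ⁅ i ⁆) + z) (∑-distrib-+ (λ i → e₁ ⁅ i ⁆) _) ⟨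
  sum (λ i → e₁ ⁅ i ⁆) + sum (λ i → e₁ ⁅ i ⁆ + sum (offDiagonal (λ i j → e₀ (⁅ i ⁆ ∪ ⁅ j ⁆)) i))
    ≡⟨ cong₂ _+_ (sum-cong-≗ (λ i → cong e₁ (sym (∪-identityˡ ⁅ i ⁆)))) (sum-cong-≗ (λ i → cong₂ _+_ (cong e₁ (sym (∪-identityʳ ⁅ i ⁆))) (sum-cong-≗ (diag i)))) ⟩
  sum² (offDiagonal {suc n} (λ i j → e (⁅ i ⁆ ∪ ⁅ j ⁆))) ∎
  where
  open ≡-Reasoning
  e₀ e₁ : Subset n → ℕ
  e₀ = e ∘ (false ∷_)
  e₁ = e ∘ (true ∷_)
  eq₁ : ∀ a b → 2 * (a + b) ≡ b + (b + 2 * a)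
  eq₁ = solve-∀
  diag : ∀ i j → offDiagonal (λ i j → e₀ (⁅ i ⁆ ∪ ⁅ j ⁆)) i j ≡ offDiagonal (λ i j → e (⁅ i ⁆ ∪ ⁅ j ⁆)) (suc i) (suc j)
  diag i j with i F.≟ j
  ... | yes _ = refl
  ... | no _  = refl

/-cross : ∀ a b c d .{{_ : NonZero b}} .{{_ : NonZero d}} → a * d ≡ c * b → (+ a) / b ≡ (+ c) / d
/-cross a (suc b) c (suc d) eq = ℚP.fromℚᵘ-cong {mkℚᵘ (+ a) b} {mkℚᵘ (+ c) d}
  (*≡* (trans (sym (ℤP.pos-* a (suc d))) (trans (cong +_ eq) (ℤP.pos-* c (suc b)))))

toℚᵘ-/ : ∀ a b → ℚ.toℚᵘ ((+ a) / suc b) ℚᵘ.≃ mkℚᵘ (+ a) b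
toℚᵘ-/ a b = ℚP.toℚᵘ-fromℚᵘ (mkℚᵘ (+ a) b)

/-+-/ : ∀ a b c d .{{_ : NonZero b}} .{{_ : NonZero d}} .{{_ : NonZero (b * d)}} →
  (+ a) / b ℚ.+ (+ c) / d ≡ (+ (a * d + c * b)) / (b * d)
/-+-/ a (suc b) c (suc d) = ℚP.toℚᵘ-injective (begin
  ℚ.toℚᵘ ((+ a) / suc b ℚ.+ (+ c) / suc d)
    ≈⟨ ℚP.toℚᵘ-homo-+ ((+ a) / suc b) ((+ c) / suc d) ⟩
  ℚ.toℚᵘ ((+ a) / suc b) ℚᵘ.+ ℚ.toℚᵘ ((+ c) / suc d)
    ≈⟨ ℚᵘP.+-cong (toℚᵘ-/ a b) (toℚᵘ-/ c d) ⟩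
  mkℚᵘ (+ a) b ℚᵘ.+ mkℚᵘ (+ c) d
    ≡⟨ cong (λ z → mkℚᵘ z _) (trans (cong₂ ℤ._+_ (sym (ℤP.pos-* a (suc d))) (sym (ℤP.pos-* c (suc b)))) (sym (ℤP.pos-+ (a * suc d) (c * suc b)))) ⟩
  mkℚᵘ (+ (a * suc d + c * suc b)) (d + b * suc d)
    ≈⟨ toℚᵘ-/ (a * suc d + c * suc b) (d + b * suc d) ⟨
  ℚ.toℚᵘ ((+ (a * suc d + c * suc b)) / (suc b * suc d)) ∎)
  where open ℚᵘP.≃-Reasoning

/-+-/-same : ∀ a c b .{{_ : NonZero b}} → (+ a) / b ℚ.+ (+ c) / b ≡ (+ (a + c)) / b
/-+-/-same a c b@(suc _) = trans (/-+-/ a b c b) (/-cross (a * b + c * b) (b * b) (a + c) b (eq a b c))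
  where
  eq : ∀ a b c → (a * b + c * b) * b ≡ (a + c) * (b * b)
  eq = solve-∀

sumSubsets-/ : ∀ n D .{{_ : NonZero D}} (f : Subset n → ℚ) (g : Subset n → ℕ) →
  (∀ A → f A ≡ (+ g A) / D) → sumSubsets n f ≡ (+ sumSubsetsℕ n g) / D
sumSubsets-/ zero    D f g h = h []
sumSubsets-/ (suc n) D f g h = trans
  (cong₂ ℚ._+_ (sumSubsets-/ n D (f ∘ (false ∷_)) (g ∘ (false ∷_)) (h ∘ (false ∷_))) (sumSubsets-/ n D (f ∘ (true ∷_)) (g ∘ (true ∷_)) (h ∘ (true ∷_))))
  (/-+-/-same (sumSubsetsℕ n (g ∘ (false ∷_))) (sumSubsetsℕ n (g ∘ (true ∷_))) D)

2*nC2 : ∀ n → 2 * (suc n C 2) ≡ suc n * n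
2*nC2 zero    = refl
2*nC2 (suc n) = begin
  2 * (suc (suc n) C 2)                ≡⟨ cong (2 *_) (nCk+nC[k+1]≡[n+1]C[k+1] (suc n) 1) ⟨
  2 * ((suc n C 1) + (suc n C 2))      ≡⟨ *-distribˡ-+ 2 (suc n C 1) (suc n C 2) ⟩
  2 * (suc n C 1) + 2 * (suc n C 2)    ≡⟨ cong₂ (λ a b → 2 * a + b) (nC1≡n (suc n)) (2*nC2 n) ⟩
  2 * suc n + suc n * n                ≡⟨ eq n ⟩
  suc (suc n) * suc n ∎
  where
  open ≡-Reasoning
  eq : ∀ n → 2 * suc n + suc n * n ≡ suc (suc n) * suc n
  eq = solve-∀

inv-/ : ∀ m x D .{{_ : NonZero D}} → x * m ≡ D → inv m ≡ (+ x) / D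
inv-/ zero    x (suc D) eq = contradiction (trans (sym (*-zeroʳ x)) eq) (λ ())
inv-/ (suc m) x D       eq = /-cross 1 (suc m) x D (trans (*-identityˡ D) (sym eq))

-- This is n(n - 1)·h(G) with n = suc k. It is used for n ≥ 2 only; the values for smaller n are
-- placeholders.
h-numerator : Hypergraph → ℕ
h-numerator (hg zero    E) = 0
h-numerator G@(hg (suc k) E) = k * count (mark G) + pairs (adj G)

h-formula : ∀ k (E : Subset (2 + k) → Bool) → Sizes12 (hg (2 + k) E) →
  h (hg (2 + k) E) ≡ (+ h-numerator (hg (2 + k) E)) / ((2 + k) * (1 + k))
h-formula k E sizes = trans (sumSubsets-/ (2 + k) D _ weight pointwise) (cong (λ z → (+ z) / D) total)
  where
  G = hg (2 + k) E
  D = (2 + k) * (1 + k)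
  weight : Subset (2 + k) → ℕ
  -- Over the common denominator D = n(n - 1), a 1-edge weighs 1/n = (n - 1)/D and a 2-edge 2/D.
  weight A = (1 + k) * (if size A ≡ᵇ 1 then ⟦ E A ⟧ else 0) + 2 * (if size A ≡ᵇ 2 then ⟦ E A ⟧ else 0)
  pointwise : ∀ A → (if E A then inv ((2 + k) C size A) else 0ℚ) ≡ (+ weight A) / D
  pointwise A with E A in eq
  ... | false = trans (/-cross 0 1 0 D refl) (cong (λ z → (+ z) / D) (zeros (size A ≡ᵇ 1) (size A ≡ᵇ 2)))
    where
    zeros : ∀ a b → 0 ≡ (1 + k) * (if a then 0 else 0) + 2 * (if b then 0 else 0)
    zeros true  true  = sym (cong (_+ 0) (*-zeroʳ k))
    zeros true  false = sym (cong (_+ 0) (*-zeroʳ k))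
    zeros false true  = sym (cong (_+ 0) (*-zeroʳ k))
    zeros false false = sym (cong (_+ 0) (*-zeroʳ k))
  ... | true with sizes A eq
  ... | inj₁ s rewrite s = trans (inv-/ ((2 + k) C 1) (1 + k) D (trans (cong ((1 + k) *_) (nC1≡n (2 + k))) (*-comm (1 + k) (2 + k))))
                             (cong (λ z → (+ z) / D) (sym (trans (+-identityʳ ((1 + k) * 1)) (*-identityʳ (1 + k)))))
  ... | inj₂ s rewrite s = trans (inv-/ ((2 + k) C 2) 2 D (2*nC2 (suc k)))
                             (cong (λ z → (+ z) / D) (sym (cong (_+ 2) (*-zeroʳ (1 + k)))))
  total : sumSubsetsℕ (2 + k) weight ≡ h-numerator G
  total = begin
    sumSubsetsℕ (2 + k) weight
      ≡⟨ sumSubsetsℕ-linear (2 + k) (1 + k) 2 (λ A → if size A ≡ᵇ 1 then ⟦ E A ⟧ else 0) (λ A → if size A ≡ᵇ 2 then ⟦ E A ⟧ else 0) ⟩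
    (1 + k) * level (2 + k) 1 (λ A → ⟦ E A ⟧) + 2 * level (2 + k) 2 (λ A → ⟦ E A ⟧)
      ≡⟨ cong₂ (λ a b → (1 + k) * a + b) (level-1 (2 + k) (λ A → ⟦ E A ⟧)) (level-2 (2 + k) (λ A → ⟦ E A ⟧)) ⟩
    (1 + k) * count (mark G) + sum² (offDiagonal (λ i j → ⟦ E (⁅ i ⁆ ∪ ⁅ j ⁆) ⟧))
      ≡⟨ cong (λ z → (1 + k) * count (mark G) + z) (sum-cong-≗ (λ i → sum-cong-≗ (off i))) ⟩
    h-numerator G ∎
    where
    open ≡-Reasoning
    off : ∀ i j → offDiagonal (λ i j → ⟦ E (⁅ i ⁆ ∪ ⁅ j ⁆) ⟧) i j ≡ ⟦ adj G i j ⟧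
    off i j with i F.≟ j
    ... | yes _ = refl
    ... | no _  = refl

∨-elim : ∀ {a b} → a ∨ b ≡ true → a ≡ true ⊎ b ≡ true
∨-elim {true}  _ = inj₁ refl
∨-elim {false} h = inj₂ h

∨-introˡ : ∀ {a b} → a ≡ true → a ∨ b ≡ true
∨-introˡ refl = refl

∨-introʳ : ∀ {a b} → b ≡ true → a ∨ b ≡ true
∨-introʳ {true}  _ = refl
∨-introʳ {false} h = h

/-≤⁻ : ∀ a b c d .{{_ : NonZero b}} .{{_ : NonZero d}} → (+ a) / b ℚ.≤ (+ c) / d → a * d ≤ c * b
/-≤⁻ a (suc b) c (suc d) le with ℚᵘP.≤-respˡ-≃ (toℚᵘ-/ a b) (ℚᵘP.≤-respʳ-≃ (toℚᵘ-/ c d) (ℚP.toℚᵘ-mono-≤ le))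
... | *≤* z = ℤP.drop‿+≤+ (subst₂ ℤ._≤_ (sym (ℤP.pos-* a (suc d))) (sym (ℤP.pos-* c (suc b))) z)

/-<⁺ : ∀ a b c d .{{_ : NonZero b}} .{{_ : NonZero d}} → a * d < c * b → (+ a) / b ℚ.< (+ c) / d
/-<⁺ a (suc b) c (suc d) lt = ℚP.toℚᵘ-cancel-< (ℚᵘP.<-respˡ-≃ (ℚᵘP.≃-sym (toℚᵘ-/ a b)) (ℚᵘP.<-respʳ-≃ (ℚᵘP.≃-sym (toℚᵘ-/ c d))
  (*<* (subst₂ ℤ._<_ (ℤP.pos-* a (suc d)) (ℤP.pos-* c (suc b)) (ℤ.+<+ lt)))))

archimedean : ∀ ε → 0ℚ ℚ.< ε → ∃ λ q → (+ 1) / suc q ℚ.≤ ε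
archimedean ε 0<ε = go ε (ℚ.positive 0<ε)
  where
  go : ∀ ε → ℚ.Positive ε → ∃ λ q → (+ 1) / suc q ℚ.≤ ε
  go (ℚ.mkℚ (+ suc a) d c) _ = d , ℚP.toℚᵘ-cancel-≤ (ℚᵘP.≤-respˡ-≃ (ℚᵘP.≃-sym (toℚᵘ-/ 1 d))
    (*≤* (ℤP.*-monoʳ-≤-nonNeg (+ suc d) {+ 1} {+ suc a} (ℤ.+≤+ (s≤s z≤n)))))

≮⇒density : ∀ p d X Y q ε .{{_ : NonZero d}} .{{_ : NonZero Y}} → (+ 1) / suc q ℚ.≤ ε →
  ¬ ((+ X) / Y ℚ.< (+ p) / d ℚ.+ ε) → (p * suc q + d) * Y ≤ X * (d * suc q)
≮⇒density p d@(suc _) X Y q ε q≤ε ¬< = subst (λ z → z * Y ≤ X * (d * suc q)) (cong (λ z → p * suc q + z) (*-identityˡ d))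
  (/-≤⁻ (p * suc q + 1 * d) (d * suc q) X Y
    (ℚP.≤-trans (ℚP.≤-reflexive (sym (/-+-/ p d 1 (suc q)))) (ℚP.≤-trans (ℚP.+-monoʳ-≤ ((+ p) / d) q≤ε) (ℚP.≮⇒≥ ¬<))))

density⇒< : ∀ p d X Y q ε .{{_ : NonZero d}} .{{_ : NonZero Y}} → (+ 1) / suc q ℚ.≤ ε →
  p * (Y * suc q) < (X * suc q + Y) * d → (+ p) / d ℚ.- ε ℚ.< (+ X) / Y
density⇒< p d X Y@(suc _) q ε q≤ε lt = begin-strict
  (+ p) / d ℚ.- ε                    <⟨ ℚP.+-monoˡ-< (ℚ.- ε) L<x+ε ⟩
  (+ X) / Y ℚ.+ ε ℚ.- ε              ≡⟨ ℚP.+-assoc ((+ X) / Y) ε (ℚ.- ε) ⟩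
  (+ X) / Y ℚ.+ (ε ℚ.- ε)            ≡⟨ cong ((+ X) / Y ℚ.+_) (ℚP.+-inverseʳ ε) ⟩
  (+ X) / Y ℚ.+ 0ℚ                   ≡⟨ ℚP.+-identityʳ _ ⟩
  (+ X) / Y ∎
  where
  open ℚP.≤-Reasoning
  L<x+ε : (+ p) / d ℚ.< (+ X) / Y ℚ.+ ε
  L<x+ε = ℚP.<-≤-trans
    (/-<⁺ p d (X * suc q + 1 * Y) (Y * suc q) (subst (λ z → p * (Y * suc q) < (X * suc q + z) * d) (sym (*-identityˡ Y)) lt))
    (ℚP.≤-trans (ℚP.≤-reflexive (sym (/-+-/ X Y 1 (suc q)))) (ℚP.+-monoʳ-≤ ((+ X) / Y) q≤ε))

-- Bounds on π

-- m/n + S/n² ≥ p/d + 1/q, cleared of denominators.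
Dense : ℕ → ℕ → ℕ → Hypergraph → Set
Dense p d q G = (p * q + d) * (v G * v G) ≤ d * q * (count (mark G) * v G + pairs (adj G))

record UpperBound (H : Hypergraph) (p d : ℕ) : Set where
  constructor upper
  field
    bound : ∀ ε → 0ℚ ℚ.< ε → ∃ λ N → ∀ n → N ≤ n → ∀ G → Admissible H n G → h G ℚ.< (+ p) / suc d ℚ.+ ε

record LowerBound (H : Hypergraph) (p d : ℕ) : Set where
  constructor lower
  field
    bound : ∀ ε → 0ℚ ℚ.< ε → ∃ λ N → ∀ n → N ≤ n → ∃ λ G → Admissible H n G × (+ p) / suc d ℚ.- ε ℚ.< h G

-- An admissible G has no copy of H, so a doubly negated copy already contradicts density. The work
-- lies in passing from n(n - 1), which occurs in h, to n², which occurs in `Dense`.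
upper-bound : ∀ H p d' → Sizes12 H →
  (∀ q → ∃ λ N → ∀ G → N ≤ v G → Dense p (suc d') (suc q) G → ¬ ¬ Hom H G) →
  UpperBound H p d'
upper-bound H p d' sizes force = upper main
  where
  d = suc d'
  main : ∀ ε → 0ℚ ℚ.< ε → ∃ λ N → ∀ n → N ≤ n → ∀ G → Admissible H n G → h G ℚ.< (+ p) / d ℚ.+ ε
  main ε 0<ε with archimedean ε 0<ε
  -- The successor of this argument computes to `2 * suc q`: half of the excess is spent on
  -- replacing n(n - 1) by n².
  ... | q , q≤ε with force (q + suc (q + 0))
  ... | N , hom-exists = N + (2 + 2 * (p * suc q + d)) , bound
    where
    bound : ∀ n → N + (2 + 2 * (p * suc q + d)) ≤ n → ∀ G → Admissible H n G → h G ℚ.< (+ p) / d ℚ.+ ε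
    bound n N≤n G (vG , sub , H⊈G) with h G ℚP.<? (+ p) / d ℚ.+ ε
    ... | yes lt = lt
    bound n N≤n (hg zero E) (refl , _) | no ¬lt =
      contradiction (≤-trans (m≤n+m (2 + 2 * (p * suc q + d)) N) N≤n) (λ ())
    bound n N≤n (hg (suc zero) E) (refl , _) | no ¬lt =
      contradiction (≤-pred (≤-trans (m≤n+m (2 + 2 * (p * suc q + d)) N) N≤n)) (λ ())
    bound n N≤n G@(hg (suc (suc k)) E) (refl , sub , H⊈G) | no ¬lt =
      contradiction (λ h → H⊈G (Hom⇒⊆H H G sizes h)) (hom-exists G (≤-trans (m≤m+n N _) N≤n) dense)
      where
      m = count (mark G)
      S = pairs (adj G)
      density : (p * suc q + d) * ((2 + k) * (1 + k)) ≤ ((1 + k) * m + S) * (d * suc q)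
      density = ≮⇒density p d (h-numerator G) ((2 + k) * (1 + k)) q ε q≤ε
        (λ lt → ¬lt (subst (ℚ._< (+ p) / d ℚ.+ ε) (sym (h-formula k E (RSub⇒Sizes12 G H sizes sub))) lt))
      arith : ∀ p d' q k m S → let d = suc d' in 2 * (p * q + d) ≤ 2 + k →
        (p * q + d) * ((2 + k) * (1 + k)) ≤ ((1 + k) * m + S) * (d * q) →
        (p * (2 * q) + d) * ((2 + k) * (2 + k)) ≤ d * (2 * q) * (m * (2 + k) + S)
      arith p d' q k m S big dens = ≤-transfer
        (+-mono-≤ (*-monoʳ-≤ 2 dens) (*-monoˡ-≤ (2 + k) big))
        (≤-trans (m≤m+n _ (2 * (m * (suc d' * q)) + d' * ((2 + k) * (2 + k)))) (≤-reflexive (eq p d' q k m S)))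
        where
        eq : ∀ p d' q k m S →
          (p * (2 * q) + suc d') * ((2 + k) * (2 + k)) + (2 * (((1 + k) * m + S) * (suc d' * q)) + (2 + k) * (2 + k)) + (2 * (m * (suc d' * q)) + d' * ((2 + k) * (2 + k)))
          ≡ suc d' * (2 * q) * (m * (2 + k) + S) + (2 * ((p * q + suc d') * ((2 + k) * (1 + k))) + 2 * (p * q + suc d') * (2 + k))
        eq = solve-∀
      dense : Dense p d (2 * suc q) G
      dense = arith p d' (suc q) k m S (≤-trans (m≤n+m _ 2) (≤-trans (m≤n+m _ N) N≤n)) density

-- Embedding H through a pattern

lookup-sections : ∀ {s t} {X : Set} (T : Vec (Vec X t) s) js a → lookup (sections T js) a ≡ lookup (lookup T a) (lookup js a)
lookup-sections (T ∷ Ts) (j ∷ js) zero    = refl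
lookup-sections (T ∷ Ts) (j ∷ js) (suc a) = lookup-sections Ts js a

Respects : ∀ H G {s} → (Fin (v H) → Fin s) → Vec (Fin (v G)) s → Set
Respects H G c w = (∀ i → mark H i ≡ true → mark G (lookup w (c i)) ≡ true)
                 × (∀ i j → Adj2 H i j → Adj2 G (lookup w (c i)) (lookup w (c j)))

-- Each class of the blow-up gets v H vertices, one position for every vertex of H, so vertices of
-- the same colour never compete for a place.
embed : ∀ H s k → ∃ λ N → ∀ G → N < v G → (c : Fin (v H) → Fin s) (A : Vec (Fin (v G)) s → Bool) →
  (∀ i j → Adj2 H i j → c i ≢ c j) → (∀ w → A w ≡ true → Respects H G c w) →
  manyᵗ k s A ≡ true → Hom H G
embed H s k with blowup s (v H) k 0
... | N , build = N , go
  where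
  go : ∀ G → N < v G → (c : Fin (v H) → Fin s) (A : Vec (Fin (v G)) s → Bool) →
    (∀ i j → Adj2 H i j → c i ≢ c j) → (∀ w → A w ≡ true → Respects H G c w) →
    manyᵗ k s A ≡ true → Hom H G
  go G N<n c A proper sound many
    with build N<n A (λ _ → false) (≤-reflexive (trans (sum-const (v G) 0) (*-zeroʳ (v G)))) many
  ... | T , _ , inj , As = hom f (λ {i} {j} → inj (c i) (c j) i j) marks edges
    where
    f : Fin (v H) → Fin (v G)
    f i = lookup (lookup T (c i)) i
    marks : ∀ i → mark H i ≡ true → mark G (f i) ≡ true
    marks i m = trans (cong (mark G) (sym (trans (lookup-sections T js (c i)) (cong (lookup (lookup T (c i))) (lookup-replicate (c i) i)))))
                  (proj₁ (sound (sections T js) (As js)) i m)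
      where js = replicate s i
    edges : ∀ i j → Adj2 H i j → Adj2 G (f i) (f j)
    edges i j ij = subst₂ (Adj2 G) (at i atᵢ) (at j atⱼ) (proj₂ (sound (sections T js) (As js)) i j ij)
      where
      -- A section through both f i and f j. It exists because adjacent vertices have different
      -- colours.
      choose : Fin s → Fin (v H)
      choose a = if ⌊ a F.≟ c i ⌋ then i else j
      js = tabulate choose
      at : ∀ l → choose (c l) ≡ l → lookup (sections T js) (c l) ≡ f l
      at l eq = trans (lookup-sections T js (c l)) (cong (lookup (lookup T (c l))) (trans (lookup∘tabulate choose (c l)) eq))
      atᵢ : choose (c i) ≡ i
      atᵢ with c i F.≟ c i
      ... | yes _ = refl
      ... | no ¬p = contradiction refl ¬p
      atⱼ : choose (c j) ≡ j
      atⱼ with c j F.≟ c i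
      ... | yes p = contradiction (sym p) (proper i j ij)
      ... | no _  = refl

-- A homomorphism from H to the pattern, expressed through the tuples w that satisfy it. The map c
-- is chosen once, for all G.
ColouredBy : Hypergraph → ∀ s → (∀ G → Vec (Fin (v G)) s → Bool) → Set
ColouredBy H s A = ∃ λ (c : Fin (v H) → Fin s) →
  (∀ i j → Adj2 H i j → c i ≢ c j) × (∀ G w → A G w ≡ true → Respects H G c w)

-- The colouring may be doubly negated, as `marks-on-one-side` supplies it, because `upper-bound`
-- asks for no more.
pattern-upper-bound : ∀ H p d' s (A : ∀ G → Vec (Fin (v G)) s → Bool) (N₀ k : ℕ → ℕ) → Sizes12 H →
  ¬ ¬ ColouredBy H s A →
  (∀ q G → N₀ q ≤ v G → Dense p (suc d') (suc q) G → manyᵗ (k q) s (A G) ≡ true) →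
  UpperBound H p d'
pattern-upper-bound H p d' s A N₀ k sizes coloured dense⇒A = upper-bound H p d' sizes force
  where
  force : ∀ q → ∃ λ N → ∀ G → N ≤ v G → Dense p (suc d') (suc q) G → ¬ ¬ Hom H G
  force q with embed H s (k q)
  ... | N , emb = suc N + N₀ q , λ G large dense ¬hom → coloured λ (c , proper , sound) →
    ¬hom (emb G (≤-trans (m≤m+n (suc N) (N₀ q)) large) c (A G) proper (sound G)
      (dense⇒A q G (≤-trans (m≤n+m (N₀ q) (suc N)) large) dense))

-- Lower bounds from blow-ups of a template

size-blowup : ℕ → ℕ → ℕ → ℕ
size-blowup r zero    s = s
size-blowup r (suc q) s = r + size-blowup r q s

-- q rounds through all colours; the s vertices left over receive colour 0 and serve only to reach n
-- exactly.
colour : ∀ r q s → Fin (size-blowup (suc r) q s) → Fin (suc r)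
colour r zero    s _ = zero
colour r (suc q) s i = [ (λ a → a) , colour r q s ]′ (splitAt (suc r) i)

size-blowup-≡ : ∀ r q s → size-blowup r q s ≡ s + q * r
size-blowup-≡ r zero    s = sym (+-identityʳ s)
size-blowup-≡ r (suc q) s = trans (cong (λ z → r + z) (size-blowup-≡ r q s)) (eq r (q * r) s)
  where
  eq : ∀ r x s → r + (s + x) ≡ s + (r + x)
  eq = solve-∀

sum-splitAt : ∀ r {m} (f : Fin (r + m) → ℕ) → sum f ≡ sum (λ a → f (a ↑ˡ m)) + sum (λ b → f (r ↑ʳ b))
sum-splitAt zero    f = refl
sum-splitAt (suc r) f = trans (cong (λ z → f zero + z) (sum-splitAt r (f ∘ suc))) (sym (+-assoc (f zero) _ _))

sum-colour : ∀ r q s (f : Fin (suc r) → ℕ) → q * sum f ≤ sum (f ∘ colour r q s)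
sum-colour r zero    s f = z≤n
sum-colour r (suc q) s f = begin
  sum f + q * sum f
    ≤⟨ +-monoʳ-≤ (sum f) (sum-colour r q s f) ⟩
  sum f + sum (f ∘ colour r q s)
    ≡⟨ cong₂ _+_ (sum-cong-≗ {x = f} (λ a → cong (f ∘ [ (λ a → a) , colour r q s ]′) (sym (FP.splitAt-↑ˡ (suc r) a _))))
                 (sum-cong-≗ {x = f ∘ colour r q s} (λ b → cong (f ∘ [ (λ a → a) , colour r q s ]′) (sym (FP.splitAt-↑ʳ (suc r) _ b)))) ⟩
  sum (λ a → f (colour r (suc q) s (a ↑ˡ size-blowup (suc r) q s))) + sum (λ b → f (colour r (suc q) s (suc r ↑ʳ b)))
    ≡⟨ sum-splitAt (suc r) (f ∘ colour r (suc q) s) ⟨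
  sum (f ∘ colour r (suc q) s) ∎
  where open ≤-Reasoning

pairs-diagonal : ∀ n → pairs (λ (i j : Fin n) → ⌊ j F.≟ i ⌋) ≡ n
pairs-diagonal n = trans (sum-cong-≗ {n} {λ i → count (λ j → ⌊ j F.≟ i ⌋)} {λ _ → 1} count-singleton) (trans (sum-const n 1) (*-identityʳ n))

-- A colour may be joined to itself, in which case its class spans a complete graph. The template
-- for 5/4 relies on this.
module Template {r : ℕ} (mk : Fin r → Bool) (ad : Fin r → Fin r → Bool) (ad-sym : ∀ a b → ad a b ≡ true → ad b a ≡ true) where

  Marked Joined : ∀ {n} → (Fin n → Fin r) → Subset n → Set
  Marked col A = ∃ λ i → A ≡ ⁅ i ⁆ × mk (col i) ≡ true
  Joined col A = ∃₂ λ i j → (A ≡ ⁅ i ⁆ ∪ ⁅ j ⁆ × i ≢ j) × ad (col i) (col j) ≡ true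

  marked? : ∀ {n} (col : Fin n → Fin r) A → Dec (Marked col A)
  marked? col A = any? (λ i → (A ≟S ⁅ i ⁆) ×-dec (mk (col i) Bool.≟ true))

  joined? : ∀ {n} (col : Fin n → Fin r) A → Dec (Joined col A)
  joined? col A = any? (λ i → any? (λ j → ((A ≟S (⁅ i ⁆ ∪ ⁅ j ⁆)) ×-dec ¬? (i F.≟ j)) ×-dec (ad (col i) (col j) Bool.≟ true)))

  graph : ∀ {n} → (Fin n → Fin r) → Hypergraph
  graph {n} col = hg n λ A → ⌊ marked? col A ⌋ ∨ ⌊ joined? col A ⌋

  module _ {n} (col : Fin n → Fin r) where

    IsEdge⁻ : ∀ A → IsEdge (graph col) A → Marked col A ⊎ Joined col A
    IsEdge⁻ A h with ∨-elim {⌊ marked? col A ⌋} h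
    ... | inj₁ p = inj₁ (dec-true⁻ p)
    ... | inj₂ p = inj₂ (dec-true⁻ p)

    sizes : Sizes12 (graph col)
    sizes A h with IsEdge⁻ A h
    ... | inj₁ (i , refl , _)             = inj₁ (∣⁅x⁆∣≡1 i)
    ... | inj₂ (i , j , (refl , i≢j) , _) = inj₂ (size-pair i≢j)

    mark⁻ : ∀ i → mark (graph col) i ≡ true → mk (col i) ≡ true
    mark⁻ i h with IsEdge⁻ ⁅ i ⁆ h
    ... | inj₁ (a , eq , m) = subst (λ x → mk (col x) ≡ true) (sym (singleton-injective eq)) m
    ... | inj₂ (a , b , (eq , a≢b) , _) = contradiction (trans (sym (∣⁅x⁆∣≡1 i)) (trans (cong size eq) (size-pair a≢b))) (λ ())

    Adj2⁻ : ∀ i j → Adj2 (graph col) i j → ad (col i) (col j) ≡ true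
    Adj2⁻ i j (i≢j , h) with IsEdge⁻ _ h
    ... | inj₁ (a , eq , _) = contradiction (trans (sym (∣⁅x⁆∣≡1 a)) (trans (cong size (sym eq)) (size-pair i≢j))) (λ ())
    ... | inj₂ (a , b , (eq , _) , m) with pair-injective i≢j eq
    ... | inj₁ (refl , refl) = m
    ... | inj₂ (refl , refl) = ad-sym _ _ m

    mark⁺ : ∀ i → mk (col i) ≡ true → mark (graph col) i ≡ true
    mark⁺ i m = ∨-introˡ (dec-true⁺ {d = marked? col ⁅ i ⁆} (i , refl , m))

    Adj2⁺ : ∀ i j → i ≢ j → ad (col i) (col j) ≡ true → Adj2 (graph col) i j
    Adj2⁺ i j i≢j m = i≢j , ∨-introʳ {⌊ marked? col (⁅ i ⁆ ∪ ⁅ j ⁆) ⌋} (dec-true⁺ {d = joined? col (⁅ i ⁆ ∪ ⁅ j ⁆)} (i , j , (refl , i≢j) , m))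

    marks-≤ : count (mk ∘ col) ≤ count (mark (graph col))
    marks-≤ = count-mono mark⁺

    -- For a colour joined to itself the diagonal pairs (i, i) are no edges; there are at most n of
    -- them.
    pairs-≤ : pairs (λ i j → ad (col i) (col j)) ≤ pairs (adj (graph col)) + n
    pairs-≤ = begin
      pairs (λ i j → ad (col i) (col j))
        ≤⟨ sum²-mono pt ⟩
      sum² (λ i j → ⟦ adj (graph col) i j ⟧ + ⟦ ⌊ j F.≟ i ⌋ ⟧)
        ≡⟨ sum²-+ (λ i j → ⟦ adj (graph col) i j ⟧) (λ i j → ⟦ ⌊ j F.≟ i ⌋ ⟧) ⟩
      pairs (adj (graph col)) + sum {n} (λ i → count (λ j → ⌊ j F.≟ i ⌋))
        ≡⟨ cong (λ z → pairs (adj (graph col)) + z) (pairs-diagonal n) ⟩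
      pairs (adj (graph col)) + n ∎
      where
      open ≤-Reasoning
      pt : ∀ i j → ⟦ ad (col i) (col j) ⟧ ≤ ⟦ adj (graph col) i j ⟧ + ⟦ ⌊ j F.≟ i ⌋ ⟧
      pt i j with j F.≟ i
      ... | yes _ = ≤-trans (⟦⟧≤1 (ad (col i) (col j))) (m≤n+m 1 _)
      ... | no j≢i = ≤-trans (⟦⟧-mono (λ m → Adj2⇒adj (graph col) (Adj2⁺ i j (j≢i ∘ sym) m))) (m≤m+n _ 0)

-- A copy of H in the blow-up, composed with the colouring, is a homomorphism to the template, so
-- excluding the latter suffices. In the limit h tends to m/R + e/R², and the denominator index is R
-- * R less one.
lower-bound : ∀ H r (mk : Fin (suc r) → Bool) (ad : Fin (suc r) → Fin (suc r) → Bool) →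
  (∀ a b → ad a b ≡ true → ad b a ≡ true) → R≡12 H →
  (∀ (φ : Fin (v H) → Fin (suc r)) → (∀ i → mark H i ≡ true → mk (φ i) ≡ true) →
     (∀ i j → Adj2 H i j → ad (φ i) (φ j) ≡ true) → ⊥) →
  LowerBound H (count mk * suc r + pairs ad) (r + r * suc r)
lower-bound H r mk ad ad-sym RH noHom = lower main
  where
  open Template mk ad ad-sym
  R = suc r
  m = count mk
  e = pairs ad
  -- Collects all errors linear in n: R * R for the diagonal pairs, the other terms for rounding n
  -- up to qR + R. Once n - 2 ≥ K · suc q₀, the total error stays below n(n - 1) / suc q₀.
  K = R * R + m * R * R + 2 * e * R + e * R * R
  main : ∀ ε → 0ℚ ℚ.< ε → ∃ λ N → ∀ n → N ≤ n → ∃ λ G → Admissible H n G × (+ (m * R + e)) / (R * R) ℚ.- ε ℚ.< h G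
  main ε 0<ε with archimedean ε 0<ε
  ... | q₀ , q₀≤ε = 2 + K * suc q₀ , construct
    where
    construct : ∀ n → 2 + K * suc q₀ ≤ n → ∃ λ G → Admissible H n G × (+ (m * R + e)) / (R * R) ℚ.- ε ℚ.< h G
    construct n N≤n = graph col , (size≡n , Sizes12⇒RSub (graph col) H RH (sizes col) , avoids) , big
      where
      q = n DivMod./ R
      s = n % R
      col = colour r q s
      size≡n : size-blowup R q s ≡ n
      size≡n = trans (size-blowup-≡ R q s) (sym (m≡m%n+[m/n]*n n R))
      avoids : ¬ (H ⊆H graph col)
      avoids H⊆ with ⊆H⇒Hom H (graph col) H⊆
      ... | hom f _ marks edges = noHom (col ∘ f) (λ i p → mark⁻ col (f i) (marks i p)) (λ i j p → Adj2⁻ col (f i) (f j) (edges i j p))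
      count≥ : q * m ≤ count (mark (graph col))
      count≥ = ≤-trans (sum-colour r q s (λ a → ⟦ mk a ⟧)) (marks-≤ col)
      pairs≥ : q * (q * e) ≤ pairs (adj (graph col)) + n
      pairs≥ = begin
        q * (q * e)                                   ≡⟨ cong (q *_) (sum-scale q (λ a → count (ad a))) ⟨
        q * sum (λ a → q * count (ad a))              ≤⟨ sum-colour r q s (λ a → q * count (ad a)) ⟩
        sum (λ i → q * count (ad (col i)))            ≤⟨ sum-mono (λ i → sum-colour r q s (λ b → ⟦ ad (col i) b ⟧)) ⟩
        pairs (λ i j → ad (col i) (col j))            ≤⟨ pairs-≤ col ⟩
        pairs (adj (graph col)) + size-blowup R q s   ≡⟨ cong (λ z → pairs (adj (graph col)) + z) size≡n ⟩
        pairs (adj (graph col)) + n ∎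
        where open ≤-Reasoning
      n≤ : n ≤ q * R + R
      n≤ = ≤-trans (≤-reflexive (trans (m≡m%n+[m/n]*n n R) (+-comm s (q * R)))) (+-monoʳ-≤ (q * R) (m%n≤n n R))
      qR≤n : q * R ≤ n
      qR≤n = ≤-trans (m≤n+m (q * R) s) (≤-reflexive (sym (m≡m%n+[m/n]*n n R)))
      numerator : ∀ k → 2 + k ≡ n → ∀ m' S → q * m ≤ m' → q * (q * e) ≤ S + n →
        (m * R + e) * ((2 + k) * (1 + k)) ≤ ((1 + k) * m' + S) * (R * R) + K * (2 + k)
      numerator k refl m' S h₁ h₂ = begin
        (m * R + e) * ((2 + k) * (1 + k))
          ≤⟨ bound₁ ⟩
        m * R * (1 + k) * (q * R + R) + e * ((q * R + R) * (q * R + R))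
          ≡⟨ eq₁ m R k q e ⟩
        (1 + k) * (q * m) * (R * R) + (q * (q * e)) * (R * R) + (m * R * R * (1 + k) + 2 * e * R * (q * R) + e * R * R)
          ≤⟨ +-mono-≤ (+-mono-≤ (*-monoˡ-≤ (R * R) (*-monoʳ-≤ (1 + k) h₁)) (*-monoˡ-≤ (R * R) h₂))
               (+-mono-≤ (+-mono-≤ (*-monoʳ-≤ (m * R * R) (n≤1+n (1 + k))) (*-monoʳ-≤ (2 * e * R) qR≤n)) (m≤m*n (e * R * R) (2 + k))) ⟩
        (1 + k) * m' * (R * R) + (S + (2 + k)) * (R * R) + (m * R * R * (2 + k) + 2 * e * R * (2 + k) + e * R * R * (2 + k))
          ≡⟨ eq₂ m R k e m' S ⟩
        ((1 + k) * m' + S) * (R * R) + K * (2 + k) ∎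
        where
        open ≤-Reasoning
        bound₁ : (m * R + e) * ((2 + k) * (1 + k)) ≤ m * R * (1 + k) * (q * R + R) + e * ((q * R + R) * (q * R + R))
        bound₁ = begin
          (m * R + e) * ((2 + k) * (1 + k))                       ≡⟨ eq₀ m R k e ⟩
          m * R * (1 + k) * (2 + k) + e * ((2 + k) * (1 + k))     ≤⟨ +-mono-≤ (*-monoʳ-≤ (m * R * (1 + k)) n≤) (*-monoʳ-≤ e (*-mono-≤ n≤ (≤-trans (n≤1+n (1 + k)) n≤))) ⟩
          m * R * (1 + k) * (q * R + R) + e * ((q * R + R) * (q * R + R)) ∎
          where
          eq₀ : ∀ m R k e → (m * R + e) * ((2 + k) * (1 + k)) ≡ m * R * (1 + k) * (2 + k) + e * ((2 + k) * (1 + k))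
          eq₀ = solve-∀
        eq₁ : ∀ m R k q e → m * R * (1 + k) * (q * R + R) + e * ((q * R + R) * (q * R + R))
          ≡ (1 + k) * (q * m) * (R * R) + (q * (q * e)) * (R * R) + (m * R * R * (1 + k) + 2 * e * R * (q * R) + e * R * R)
        eq₁ = solve-∀
        eq₂ : ∀ m R k e m' S → (1 + k) * m' * (R * R) + (S + (2 + k)) * (R * R) + (m * R * R * (2 + k) + 2 * e * R * (2 + k) + e * R * R * (2 + k))
          ≡ ((1 + k) * m' + S) * (R * R) + (R * R + m * R * R + 2 * e * R + e * R * R) * (2 + k)
        eq₂ = solve-∀
      final : ∀ k X → K * suc q₀ ≤ k → (m * R + e) * ((2 + k) * (1 + k)) ≤ X * (R * R) + K * (2 + k) →
        (m * R + e) * ((2 + k) * (1 + k) * suc q₀) < (X * suc q₀ + (2 + k) * (1 + k)) * (R * R)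
      final k X Kq≤k h = begin-strict
        (m * R + e) * ((2 + k) * (1 + k) * suc q₀)                ≡⟨ *-assoc (m * R + e) _ (suc q₀) ⟨
        (m * R + e) * ((2 + k) * (1 + k)) * suc q₀                ≤⟨ *-monoˡ-≤ (suc q₀) h ⟩
        (X * (R * R) + K * (2 + k)) * suc q₀                      ≡⟨ eq₁ X (R * R) K k (suc q₀) ⟩
        X * suc q₀ * (R * R) + (2 + k) * (K * suc q₀)             ≤⟨ +-monoʳ-≤ (X * suc q₀ * (R * R)) (*-monoʳ-≤ (2 + k) Kq≤k) ⟩
        X * suc q₀ * (R * R) + (2 + k) * k                        <⟨ +-monoʳ-< (X * suc q₀ * (R * R)) (*-monoʳ-< (2 + k) (n<1+n k)) ⟩
        X * suc q₀ * (R * R) + (2 + k) * (1 + k)                  ≤⟨ +-monoʳ-≤ (X * suc q₀ * (R * R)) (m≤m*n ((2 + k) * (1 + k)) (R * R)) ⟩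
        X * suc q₀ * (R * R) + (2 + k) * (1 + k) * (R * R)        ≡⟨ *-distribʳ-+ (R * R) (X * suc q₀) ((2 + k) * (1 + k)) ⟨
        (X * suc q₀ + (2 + k) * (1 + k)) * (R * R) ∎
        where
        open ≤-Reasoning
        eq₁ : ∀ X RR K k q → (X * RR + K * (2 + k)) * q ≡ X * q * RR + (2 + k) * (K * q)
        eq₁ = solve-∀
      big : (+ (m * R + e)) / (R * R) ℚ.- ε ℚ.< h (graph col)
      big = go (graph col) size≡n (sizes col) count≥ pairs≥
        where
        go : ∀ G → v G ≡ n → Sizes12 G → q * m ≤ count (mark G) → q * (q * e) ≤ pairs (adj G) + n →
          (+ (m * R + e)) / (R * R) ℚ.- ε ℚ.< h G
        go (hg zero E) refl _ _ _ = contradiction N≤n (λ ())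
        go (hg (suc zero) E) refl _ _ _ = contradiction (≤-pred N≤n) (λ ())
        go G@(hg (suc (suc k)) E) refl sz h₁ h₂ = subst ((+ (m * R + e)) / (R * R) ℚ.- ε ℚ.<_) (sym (h-formula k E sz))
          (density⇒< (m * R + e) (R * R) (h-numerator G) ((2 + k) * (1 + k)) q₀ ε q₀≤ε
            (final k (h-numerator G) (≤-pred (≤-pred N≤n)) (numerator k refl (count (mark G)) (pairs (adj G)) h₁ h₂)))

-- Closed paths and colourings

record ClosedPath (H : Hypergraph) (ℓ : ℕ) : Set where
  constructor closed
  field
    fn        : Fin (suc ℓ) → Fin (v H)
    injective : Injective _≡_ _≡_ fn
    start     : mark H (fn zero) ≡ true
    end       : mark H (fn (fromℕ ℓ)) ≡ true
    steps     : ∀ i → Adj2 H (fn (inject₁ i)) (fn (suc i))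

closedPath-IsEdge⁻ : ∀ ℓ A → IsEdge (closedPath ℓ) A →
  A ≡ ⁅ zero ⁆ ⊎ A ≡ ⁅ fromℕ ℓ ⁆ ⊎ (∃ λ (i : Fin ℓ) → A ≡ ⁅ inject₁ i ⁆ ∪ ⁅ suc i ⁆)
closedPath-IsEdge⁻ ℓ A h with ∨-elim {⌊ A ≟S ⁅ zero ⁆ ⌋} h
... | inj₁ p = inj₁ (dec-true⁻ p)
... | inj₂ h' with ∨-elim {⌊ A ≟S ⁅ fromℕ ℓ ⁆ ⌋} h'
... | inj₁ p = inj₂ (inj₁ (dec-true⁻ p))
... | inj₂ p = inj₂ (inj₂ (dec-true⁻ p))

ClosedPath⇒⊆H : ∀ H ℓ → ClosedPath H ℓ → closedPath ℓ ⊆H H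
ClosedPath⇒⊆H H ℓ (closed f inj start end steps) = f , inj , go
  where
  go : ∀ A → IsEdge (closedPath ℓ) A → IsEdge H (image f A)
  go A h with closedPath-IsEdge⁻ ℓ A h
  ... | inj₁ refl              = trans (cong (E H) (image-singleton f zero)) start
  ... | inj₂ (inj₁ refl)       = trans (cong (E H) (image-singleton f (fromℕ ℓ))) end
  ... | inj₂ (inj₂ (i , refl)) = trans (cong (E H) (image-pair f (inject₁ i) (suc i))) (proj₂ (steps i))

inject₁≢suc : ∀ {ℓ} (i : Fin ℓ) → inject₁ i ≢ suc i
inject₁≢suc (suc i) eq = inject₁≢suc i (FP.suc-injective eq)

⊆H⇒ClosedPath : ∀ H ℓ → closedPath ℓ ⊆H H → ClosedPath H ℓ
⊆H⇒ClosedPath H ℓ P⊆H with ⊆H⇒Hom (closedPath ℓ) H P⊆H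
... | hom f inj marks edges = closed f inj
  (marks zero (∨-introˡ {⌊ A₁ ≟S A₁ ⌋} (dec-true⁺ {d = A₁ ≟S A₁} refl)))
  (marks (fromℕ ℓ) (∨-introʳ {⌊ A₂ ≟S A₁ ⌋} (∨-introˡ {⌊ A₂ ≟S A₂ ⌋} (dec-true⁺ {d = A₂ ≟S A₂} refl))))
  (λ i → edges (inject₁ i) (suc i) (inject₁≢suc i , ∨-introʳ {⌊ pair i ≟S A₁ ⌋} (∨-introʳ {⌊ pair i ≟S A₂ ⌋} (dec-true⁺ {d = any? (λ j → pair i ≟S pair j)} (i , refl)))))
  where
  A₁ A₂ : Subset (suc ℓ)
  A₁ = ⁅ zero ⁆
  A₂ = ⁅ fromℕ ℓ ⁆
  pair : Fin ℓ → Subset (suc ℓ)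
  pair i = ⁅ inject₁ i ⁆ ∪ ⁅ suc i ⁆

data Connected (H : Hypergraph) : Fin (v H) → Fin (v H) → Set where
  here : ∀ {u} → Connected H u u
  step : ∀ {u w x} → Adj2 H u w → Connected H w x → Connected H u x

Connected-trans : ∀ {H u w x} → Connected H u w → Connected H w x → Connected H u x
Connected-trans here       q = q
Connected-trans (step a p) q = step a (Connected-trans p q)

Connected-sym : ∀ {H u w} → Connected H u w → Connected H w u
Connected-sym here = here
Connected-sym {H} (step a p) = Connected-trans (Connected-sym p) (step (Adj2-sym H a) here)

record SimplePath (H : Hypergraph) (u w : Fin (v H)) : Set where
  constructor simple
  field
    len       : ℕ
    fn        : Fin (suc len) → Fin (v H)
    injective : Injective _≡_ _≡_ fn
    start     : fn zero ≡ u
    end       : fn (fromℕ len) ≡ w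
    steps     : ∀ i → Adj2 H (fn (inject₁ i)) (fn (suc i))

suffix : ∀ {H} ℓ (f : Fin (suc ℓ) → Fin (v H)) → Injective _≡_ _≡_ f →
  (∀ i → Adj2 H (f (inject₁ i)) (f (suc i))) → ∀ i → SimplePath H (f i) (f (fromℕ ℓ))
suffix ℓ       f inj steps zero    = simple ℓ f inj refl refl steps
suffix (suc ℓ) f inj steps (suc i) = suffix ℓ (f ∘ suc) (FP.suc-injective ∘ inj) (steps ∘ suc) i

-- If the new first vertex already lies on the path, everything before that occurrence is cut off.
Connected⇒SimplePath : ∀ {H u w} → Connected H u w → SimplePath H u w
Connected⇒SimplePath {u = u} here = simple 0 (λ _ → u) (λ { {zero} {zero} _ → refl }) refl refl (λ ())
Connected⇒SimplePath {H} {u} (step a p) with Connected⇒SimplePath p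
... | simple ℓ f inj refl refl steps with any? (λ i → f i F.≟ u)
... | yes (i , refl) = suffix {H} ℓ f inj steps i
... | no fresh = simple (suc ℓ) f' inj' refl refl steps'
  where
  f' : Fin (suc (suc ℓ)) → Fin (v H)
  f' zero    = u
  f' (suc i) = f i
  inj' : Injective _≡_ _≡_ f'
  inj' {zero}  {zero}  _  = refl
  inj' {zero}  {suc j} eq = contradiction (j , sym eq) fresh
  inj' {suc i} {zero}  eq = contradiction (i , eq) fresh
  inj' {suc i} {suc j} eq = cong suc (inj eq)
  steps' : ∀ i → Adj2 H (f' (inject₁ i)) (f' (suc i))
  steps' zero    = a
  steps' (suc i) = steps i

alternate : ℕ → Bool → Bool
alternate zero    b = b
alternate (suc ℓ) b = not (alternate ℓ b)

alternate-not : ∀ ℓ b → alternate ℓ (not b) ≡ not (alternate ℓ b)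
alternate-not zero    b = refl
alternate-not (suc ℓ) b = cong not (alternate-not ℓ b)

alternating⇒alternate : ∀ ℓ (g : Fin (suc ℓ) → Bool) → (∀ i → g (suc i) ≡ not (g (inject₁ i))) →
  g (fromℕ ℓ) ≡ alternate ℓ (g zero)
alternating⇒alternate zero    g alt = refl
alternating⇒alternate (suc ℓ) g alt =
  trans (alternating⇒alternate ℓ (g ∘ suc) (alt ∘ suc)) (trans (cong (alternate ℓ) (alt zero)) (alternate-not ℓ (g zero)))

2*suc : ∀ k → 2 * suc k ≡ suc (suc (2 * k))
2*suc = solve-∀

alternate-odd⁻ : ∀ ℓ b → alternate ℓ b ≢ b → ∃ λ k → ℓ ≡ suc (2 * k)
alternate-odd⁻ zero          b h = contradiction refl h
alternate-odd⁻ (suc zero)    b h = 0 , refl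
alternate-odd⁻ (suc (suc ℓ)) b h with alternate-odd⁻ ℓ b (h ∘ trans (not-involutive _))
... | k , refl = suc k , cong suc (sym (2*suc k))

alternate-even : ∀ k b → alternate (2 * k) b ≡ b
alternate-even zero    b = refl
alternate-even (suc k) b = trans (cong (λ ℓ → alternate ℓ b) (2*suc k)) (trans (not-involutive _) (alternate-even k b))

isZero : Fin 2 → Bool
isZero zero    = true
isZero (suc _) = false

isZero-≢ : ∀ {a b} → a ≢ b → isZero b ≡ not (isZero a)
isZero-≢ {zero}     {zero}     h = contradiction refl h
isZero-≢ {zero}     {suc zero} h = refl
isZero-≢ {suc zero} {zero}     h = refl
isZero-≢ {suc zero} {suc zero} h = contradiction refl h

Proper : (H : Hypergraph) → (Fin (v H) → Bool) → Set
Proper H κ = ∀ i j → Adj2 H i j → κ j ≡ not (κ i)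

-- A simple path between marked vertices of different colours has odd length, hence an even number
-- of vertices: it is a forbidden P̄₂ₖ.
marks-monochromatic : ∀ H κ → Proper H κ → (∀ k → ¬ (P̄2k k ⊆H H)) →
  ∀ {u w} → mark H u ≡ true → mark H w ≡ true → Connected H u w → κ u ≡ κ w
marks-monochromatic H κ proper noP {u} {w} mu mw uw with κ u Bool.≟ κ w
... | yes eq = eq
... | no neq with Connected⇒SimplePath uw
... | simple ℓ f inj refl refl steps with alternate-odd⁻ ℓ (κ (f zero))
        (λ eq → neq (sym (trans (alternating⇒alternate ℓ (κ ∘ f) (λ i → proper _ _ (steps i))) eq)))
... | k , refl = contradiction (ClosedPath⇒⊆H H _ (closed f inj mu mw steps)) (noP k)

-- Double negation shift, constructively valid over a finite index set.
¬¬-Π : ∀ n {P : Fin n → Set} → (∀ i → ¬ ¬ P i) → ¬ ¬ (∀ i → P i)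
¬¬-Π zero    h k = k (λ ())
¬¬-Π (suc n) h k = h zero (λ p → ¬¬-Π n (h ∘ suc) (λ ps → k (λ { zero → p ; (suc i) → ps i })))

-- κ is flipped on components; the double negation pays for deciding connectedness to a marked vertex.
marks-on-one-side : ∀ H κ → Proper H κ → (∀ k → ¬ (P̄2k k ⊆H H)) →
  ¬ ¬ (∃ λ κ' → Proper H κ' × (∀ i → mark H i ≡ true → κ' i ≡ true))
marks-on-one-side H κ proper noP none = ¬¬-Π (v H) (λ _ → ¬¬-excluded-middle) (none ∘ build)
  where
  Reaches : Fin (v H) → Set
  Reaches i = ∃ λ u → mark H u ≡ true × Connected H i u
  flip : ∀ i → Dec (Reaches i) → Bool
  -- The colour of i relative to u. By `marks-monochromatic` it does not matter which marked vertex
  -- of the component was found.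
  flip i (yes (u , _)) = ⌊ κ i Bool.≟ κ u ⌋
  flip i (no _)        = κ i
  flip-not : ∀ {a b c d} → b ≡ not a → c ≡ d → ⌊ b Bool.≟ d ⌋ ≡ not ⌊ a Bool.≟ c ⌋
  flip-not {true}  {c = true}  refl refl = refl
  flip-not {true}  {c = false} refl refl = refl
  flip-not {false} {c = true}  refl refl = refl
  flip-not {false} {c = false} refl refl = refl
  build : (∀ i → Dec (Reaches i)) → ∃ λ κ' → Proper H κ' × (∀ i → mark H i ≡ true → κ' i ≡ true)
  build dec = (λ i → flip i (dec i)) , (λ i j ij → proper' i j ij (dec i) (dec j)) , (λ i m → marked' i m (dec i))
    where
    proper' : ∀ i j → Adj2 H i j → ∀ di dj → flip j dj ≡ not (flip i di)
    proper' i j ij (yes (u , mu , iu)) (yes (w , mw , jw)) =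
      flip-not (proper i j ij) (marks-monochromatic H κ proper noP mu mw (Connected-trans (Connected-sym iu) (step ij jw)))
    proper' i j ij (yes (u , mu , iu)) (no ¬r) = contradiction (u , mu , step (Adj2-sym H ij) iu) ¬r
    proper' i j ij (no ¬r) (yes (w , mw , jw)) = contradiction (w , mw , step ij jw) ¬r
    proper' i j ij (no _) (no _) = proper i j ij
    marked' : ∀ i → mark H i ≡ true → ∀ di → flip i di ≡ true
    marked' i m (yes (u , mu , iu)) = dec-true⁺ {d = κ i Bool.≟ κ u} (marks-monochromatic H κ proper noP m mu iu)
    marked' i m (no ¬r) = contradiction (i , m , here) ¬r

-- The four cases

PiEquals-intro : ∀ H {L} p d p' d' → (+ p) / suc d ≡ L → (+ p') / suc d' ≡ L →
  UpperBound H p d → LowerBound H p' d' → PiEquals H L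
PiEquals-intro H p d p' d' refl eq (upper up) (lower low) ε 0<ε with up ε 0<ε | low ε 0<ε
... | N₁ , up' | N₂ , low' = N₁ ⊔ N₂ , λ n n≥N →
  up' n (≤-trans (m≤m⊔n N₁ N₂) n≥N) ,
  subst (λ L → ∃ λ G → Admissible H n G × L ℚ.- ε ℚ.< h G) eq (low' n (≤-trans (m≤n⊔m N₁ N₂) n≥N))

Colourable2-mono : ∀ H {k m} → k ≤ m → Colourable2 H k → Colourable2 H m
Colourable2-mono H k≤m (c , proper) = (λ i → F.inject≤ (c i) k≤m) ,
  λ i j ij eq → proper i j ij (FP.inject≤-injective k≤m k≤m (c i) (c j) eq)

clique-Respects : ∀ H G {s} (c : Fin (v H) → Fin s) → (∀ i j → Adj2 H i j → c i ≢ c j) →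
  ∀ w → cliqueIn (adj G) (mark G) w ≡ true → Respects H G c w
clique-Respects H G c proper w clique =
  (λ i _ → cliqueIn-⊆ (adj G) (mark G) w clique (c i)) ,
  (λ i j ij → adj⇒Adj2 G (cliqueIn-adj (adj G) (adj-sym G) (mark G) w clique (c i) (c j) (proper i j ij)))

upper-nonbipartite : ∀ H r → Sizes12 H → Colourable2 H (3 + r) → UpperBound H (3 + 2 * r) (1 + r)
upper-nonbipartite H r sizes (c , proper) = pattern-upper-bound H (3 + 2 * r) (1 + r) (3 + r)
  (λ G → cliqueIn (adj G) (mark G)) (λ q → 3 * suc r * suc q + 1) (λ q → 3 * ((2 + r) * suc q) * (3 * ((2 + r) * suc q)))
  sizes (λ no → no (c , proper , λ G → clique-Respects H G c proper))
  (λ q G → many-cliques (adj G) (adj-sym G) (mark G) r q)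

upper-marked-edge : ∀ H → Sizes12 H → Colourable2 H 2 → UpperBound H 5 3
upper-marked-edge H sizes (c , proper) = pattern-upper-bound H 5 3 2
  (λ G → cliqueIn (adj G) (mark G)) (λ _ → 1) (λ q → 3 * (1 * suc q) * (3 * (1 * suc q)))
  sizes (λ no → no (c , proper , λ G → clique-Respects H G c proper))
  (λ q G → many-marked-edges (adj G) (adj-sym G) (mark G) q)

-- Sends a vertex with given side and mark to its position in P₄-pattern.
class₄ : Bool → Bool → Fin 4
class₄ false false = zero
class₄ true  false = suc zero
class₄ true  true  = suc (suc zero)
class₄ false true  = suc (suc (suc zero))

-- Of the four pairs of vertices on opposite sides of P̄₄, only x₁x₄ is not an edge. Both of these
-- are marked, so independence of the marked vertices rules out just this pair.
upper-P₄ : ∀ H → Sizes12 H → ∀ κ → Proper H κ → (∀ i j → Adj2 H i j → mark H i ≡ true → mark H j ≢ true) →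
  UpperBound H 9 7
upper-P₄ H sizes κ proper independent = pattern-upper-bound H 9 7 4
  (λ G → P₄-pattern (mark G) (adj G)) (λ _ → 0) (λ q → 2 * (2 * suc q))
  sizes (λ no → no (c , c-proper , respects))
  (λ q G _ → many-P₄ (adj G) (adj-sym G) (mark G) (suc q))
  where
  c : Fin (v H) → Fin 4
  c i = class₄ (κ i) (mark H i)
  c-proper : ∀ i j → Adj2 H i j → c i ≢ c j
  c-proper i j ij eq = go (κ i) (κ j) (mark H i) (mark H j) (proper i j ij) eq
    where
    go : ∀ a b x y → b ≡ not a → class₄ a x ≢ class₄ b y
    go true  .false true  true  refl ()
    go true  .false true  false refl ()
    go true  .false false true  refl ()
    go true  .false false false refl ()
    go false .true  true  true  refl ()
    go false .true  true  false refl ()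
    go false .true  false true  refl ()
    go false .true  false false refl ()
  respects : ∀ G w → P₄-pattern (mark G) (adj G) w ≡ true → Respects H G c w
  respects G (u ∷ w ∷ x ∷ y ∷ []) p = (λ i → marks (κ i) (mark H i)) ,
    (λ i j ij → edges (κ i) (κ j) (mark H i) (mark H j) (proper i j ij) (independent i j ij))
    where
    P = u ∷ w ∷ x ∷ y ∷ []
    ux = ∧-elim {mark G x} (proj₁ (∧-elim {mark G x ∧ adj G u x} p))
    wy,uw = ∧-elim {mark G y ∧ adj G w y} (proj₂ (∧-elim {mark G x ∧ adj G u x} p))
    wy = ∧-elim {mark G y} (proj₁ wy,uw)
    ux′ = adj⇒Adj2 G (proj₂ ux)
    wy′ = adj⇒Adj2 G (proj₂ wy)
    uw′ = adj⇒Adj2 G (proj₂ wy,uw)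
    marks : ∀ a m → m ≡ true → mark G (lookup P (class₄ a m)) ≡ true
    marks true  true _ = proj₁ ux
    marks false true _ = proj₁ wy
    edges : ∀ a b m m' → b ≡ not a → (m ≡ true → m' ≢ true) → Adj2 G (lookup P (class₄ a m)) (lookup P (class₄ b m'))
    edges a     b      true  true  _    f = contradiction refl (f refl)
    edges true  .false true  false refl _ = Adj2-sym G ux′
    edges true  .false false true  refl _ = wy′
    edges true  .false false false refl _ = Adj2-sym G uw′
    edges false .true  true  false refl _ = Adj2-sym G wy′
    edges false .true  false true  refl _ = ux′
    edges false .true  false false refl _ = uw′

upper-half-marked-edge : ∀ H → Sizes12 H → ¬ ¬ (∃ λ κ → Proper H κ × (∀ i → mark H i ≡ true → κ i ≡ true)) →
  UpperBound H 1 0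
upper-half-marked-edge H sizes colouring = pattern-upper-bound H 1 0 2
  -- `1 * suc q` is the form in which `Dense` with p = d = 1 delivers the coefficient.
  (λ G → edge-pattern (mark G) (adj G)) (λ _ → 0) (λ q → 2 * (2 * (1 * suc q)))
  sizes (λ no → colouring λ (κ , proper , one) →
    no (side ∘ κ , (λ i j ij → side-proper (κ i) (κ j) (proper i j ij)) , λ G → respects G κ proper one))
  (λ q G _ → many-half-marked-edges (adj G) (adj-sym G) (mark G) (1 * suc q))
  where
  side : Bool → Fin 2
  side true  = zero
  side false = suc zero
  side-proper : ∀ a b → b ≡ not a → side a ≢ side b
  side-proper true  .false refl ()
  side-proper false .true  refl ()
  respects : ∀ G κ → Proper H κ → (∀ i → mark H i ≡ true → κ i ≡ true) →
    ∀ w → edge-pattern (mark G) (adj G) w ≡ true → Respects H G (side ∘ κ) w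
  respects G κ proper one (u ∷ w ∷ []) p = (λ i m → marks (κ i) (one i m)) , (λ i j ij → edges (κ i) (κ j) (proper i j ij))
    where
    uw = adj⇒Adj2 G (proj₂ (∧-elim {mark G u} p))
    marks : ∀ a → a ≡ true → mark G (lookup (u ∷ w ∷ []) (side a)) ≡ true
    marks true _ = proj₁ (∧-elim {mark G u} p)
    edges : ∀ a b → b ≡ not a → Adj2 G (lookup (u ∷ w ∷ []) (side a)) (lookup (u ∷ w ∷ []) (side b))
    edges true  .false refl = uw
    edges false .true  refl = Adj2-sym G uw

pairs-offDiagonal : ∀ n → pairs (λ (a b : Fin n) → not ⌊ b F.≟ a ⌋) + n ≡ n * n
pairs-offDiagonal n = begin
  pairs ne + n                                ≡⟨ cong (λ z → pairs ne + z) (pairs-diagonal n) ⟨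
  pairs ne + pairs eq                         ≡⟨ sum-+ (count ∘ ne) (count ∘ eq) ⟨
  sum (λ a → count (ne a) + count (eq a))     ≡⟨ sum-cong-≗ {n} {λ a → count (ne a) + count (eq a)} {λ _ → n} (λ a → trans (+-comm (count (ne a)) _) (count-not (eq a))) ⟩
  sum {n} (λ _ → n)                           ≡⟨ sum-const n n ⟩
  n * n ∎
  where
  open ≡-Reasoning
  eq ne : Fin n → Fin n → Bool
  eq a b = ⌊ b F.≟ a ⌋
  ne a b = not (eq a b)

nonbipartite : ∀ H → R≡12 H → ∀ r → IsChromatic2 H (3 + r) → PiEquals H ((+ 2) / 1 ℚ.- inv (2 + r))
nonbipartite H RH r (colouring , minimal) = PiEquals-intro H (3 + 2 * r) (1 + r) (count {R} (λ _ → true) * R + pairs ne) _ L₁≡L (trans L₂≡L₁ L₁≡L)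
  (upper-nonbipartite H r (proj₁ RH) colouring)
  (lower-bound H (suc r) (λ _ → true) ne ne-sym RH
    -- A homomorphism to the complete template would colour H² with χ - 1 colours.
    (λ φ _ edges → 1+n≰n (minimal (2 + r) (φ , λ i j ij → ne⁻ (φ i) (φ j) (edges i j ij)))))
  where
  R = 2 + r
  ne : Fin R → Fin R → Bool
  ne a b = not ⌊ b F.≟ a ⌋
  ne⁻ : ∀ a b → ne a b ≡ true → a ≢ b
  ne⁻ a b h with b F.≟ a
  ... | no b≢a = b≢a ∘ sym
  ne-sym : ∀ a b → ne a b ≡ true → ne b a ≡ true
  ne-sym a b h with a F.≟ b
  ... | yes p = contradiction p (ne⁻ a b h)
  ... | no _  = refl
  marks≡ : count {R} (λ _ → true) ≡ R
  marks≡ = trans (sum-const R 1) (*-identityʳ R)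
  pairs≡ : pairs ne + R ≡ R * R
  pairs≡ = pairs-offDiagonal R
  L₂≡L₁ : (+ (count {R} (λ _ → true) * R + pairs ne)) / (R * R) ≡ (+ (3 + 2 * r)) / R
  L₂≡L₁ = /-cross (count {R} (λ _ → true) * R + pairs ne) (R * R) (3 + 2 * r) R (arith (count {R} (λ _ → true)) (pairs ne) marks≡ pairs≡)
    where
    arith : ∀ m e → m ≡ 2 + r → e + (2 + r) ≡ (2 + r) * (2 + r) → (m * (2 + r) + e) * (2 + r) ≡ (3 + 2 * r) * ((2 + r) * (2 + r))
    arith m e refl eq = trans (cong (λ z → z * (2 + r)) numerator) (*-assoc (3 + 2 * r) (2 + r) (2 + r))
      where
      ring : ∀ r → (2 + r) * (2 + r) + (2 + r) * (2 + r) ≡ (3 + 2 * r) * (2 + r) + (2 + r)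
      ring = solve-∀
      numerator : (2 + r) * (2 + r) + e ≡ (3 + 2 * r) * (2 + r)
      numerator = +-cancelʳ-≡ (2 + r) ((2 + r) * (2 + r) + e) ((3 + 2 * r) * (2 + r))
        (trans (+-assoc ((2 + r) * (2 + r)) e (2 + r)) (trans (cong (λ z → (2 + r) * (2 + r) + z) eq) (ring r)))
  L₁≡L : (+ (3 + 2 * r)) / R ≡ (+ 2) / 1 ℚ.- inv R
  L₁≡L = begin
    (+ (3 + 2 * r)) / R                                   ≡⟨ ℚP.+-identityʳ _ ⟨
    (+ (3 + 2 * r)) / R ℚ.+ 0ℚ                            ≡⟨ cong ((+ (3 + 2 * r)) / R ℚ.+_) (ℚP.+-inverseʳ (inv R)) ⟨
    (+ (3 + 2 * r)) / R ℚ.+ (inv R ℚ.- inv R)             ≡⟨ ℚP.+-assoc ((+ (3 + 2 * r)) / R) (inv R) (ℚ.- inv R) ⟨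
    (+ (3 + 2 * r)) / R ℚ.+ inv R ℚ.- inv R               ≡⟨ cong (ℚ._- inv R) (/-+-/-same (3 + 2 * r) 1 R) ⟩
    (+ (3 + 2 * r + 1)) / R ℚ.- inv R                     ≡⟨ cong (ℚ._- inv R) (/-cross (3 + 2 * r + 1) R 2 1 (ring r)) ⟩
    (+ 2) / 1 ℚ.- inv R ∎
    where
    open ≡-Reasoning
    ring : ∀ r → (3 + 2 * r + 1) * 1 ≡ 2 * (2 + r)
    ring = solve-∀

bipartite⇒Proper : ∀ H ((c , _) : Bipartite2 H) → Proper H (isZero ∘ c)
bipartite⇒Proper H (c , proper) i j ij = isZero-≢ (proper i j ij)

bipartite-marked-edge : ∀ H → R≡12 H → Bipartite2 H → P̄2k 0 ⊆H H → PiEquals H ((+ 5) / 4)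
bipartite-marked-edge H RH bip P⊆H = PiEquals-intro H 5 3 5 3 refl refl (upper-marked-edge H (proj₁ RH) bip)
  -- One of two colours is marked and three of the four ordered colour pairs are joined, the
  -- unmarked colour also to itself: 1/2 + 3/4 = 5/4.
  (lower-bound H 1 isZero notBoth notBoth-sym RH avoid)
  where
  notBoth : Fin 2 → Fin 2 → Bool
  notBoth a b = not (isZero a ∧ isZero b)
  notBoth-sym : ∀ a b → notBoth a b ≡ true → notBoth b a ≡ true
  notBoth-sym zero       (suc zero) _ = refl
  notBoth-sym (suc zero) zero       _ = refl
  notBoth-sym (suc zero) (suc zero) _ = refl
  avoid : (φ : Fin (v H) → Fin 2) → (∀ i → mark H i ≡ true → isZero (φ i) ≡ true) →
    (∀ i j → Adj2 H i j → notBoth (φ i) (φ j) ≡ true) → ⊥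
  avoid φ marks edges with ⊆H⇒ClosedPath H 1 P⊆H
  ... | closed f _ start end steps = absurd (marks _ start) (marks _ end) (edges _ _ (steps zero))
    where
    absurd : ∀ {a b} → isZero a ≡ true → isZero b ≡ true → notBoth a b ≡ true → ⊥
    absurd {zero} {zero} _ _ ()

bipartite-closed-path : ∀ H → R≡12 H → Bipartite2 H → (∃ λ k → P̄2k k ⊆H H) → ¬ (P̄2k 0 ⊆H H) → PiEquals H ((+ 9) / 8)
bipartite-closed-path H RH bip (k , P⊆H) noP₂ = PiEquals-intro H 9 7 18 15 refl refl
  (upper-P₄ H (proj₁ RH) _ (bipartite⇒Proper H bip) independent)
  -- Colour classes have equal size, so marking 3/4 takes four colours: (3 · 4 + 6)/16 = 18/16.
  (lower-bound H 3 isMarked differ differ-sym RH avoid)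
  where
  independent : ∀ i j → Adj2 H i j → mark H i ≡ true → mark H j ≢ true
  independent i j ij mi mj = noP₂ (ClosedPath⇒⊆H H 1 (closed f inj mi mj (λ { zero → ij })))
    where
    f : Fin 2 → Fin (v H)
    f zero    = i
    f (suc _) = j
    inj : Injective _≡_ _≡_ f
    inj {zero}     {zero}     _  = refl
    inj {zero}     {suc zero} eq = contradiction eq (proj₁ ij)
    inj {suc zero} {zero}     eq = contradiction (sym eq) (proj₁ ij)
    inj {suc zero} {suc zero} _  = refl
  isMarked : Fin 4 → Bool
  isMarked zero    = false
  isMarked (suc _) = true
  _≠ᵇ_ : Bool → Bool → Bool
  true  ≠ᵇ b = not b
  false ≠ᵇ b = b
  differ : Fin 4 → Fin 4 → Bool
  differ a b = isMarked a ≠ᵇ isMarked b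
  ≠ᵇ-sym : ∀ a b → a ≠ᵇ b ≡ true → b ≠ᵇ a ≡ true
  ≠ᵇ-sym true  false _ = refl
  ≠ᵇ-sym false true  _ = refl
  ≠ᵇ⇒not : ∀ a b → a ≠ᵇ b ≡ true → b ≡ not a
  ≠ᵇ⇒not true  false _ = refl
  ≠ᵇ⇒not false true  _ = refl
  differ-sym : ∀ a b → differ a b ≡ true → differ b a ≡ true
  differ-sym a b = ≠ᵇ-sym (isMarked a) (isMarked b)
  avoid : (φ : Fin (v H) → Fin 4) → (∀ i → mark H i ≡ true → isMarked (φ i) ≡ true) →
    (∀ i j → Adj2 H i j → differ (φ i) (φ j) ≡ true) → ⊥
  -- Marked and unmarked vertices alternate along 1 + 2k edges, so the two ends cannot both be
  -- marked.
  avoid φ marks edges with ⊆H⇒ClosedPath H (suc (2 * k)) P⊆H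
  ... | closed f _ start end steps = absurd (marks _ start)
    (trans (sym (marks _ end)) (trans (alternating⇒alternate (suc (2 * k)) (isMarked ∘ φ ∘ f) (λ i → ≠ᵇ⇒not _ _ (edges _ _ (steps i))))
      (cong not (alternate-even k (isMarked (φ (f zero)))))))
    where
    absurd : ∀ {b} → b ≡ true → true ≡ not b → ⊥
    absurd refl ()

bipartite-no-closed-path : ∀ H → R≡12 H → Bipartite2 H → (∀ k → ¬ (P̄2k k ⊆H H)) → PiEquals H 1ℚ
bipartite-no-closed-path H RH@(sizes , _ , (A , A∈E , |A|≡2)) bip noP = PiEquals-intro H 1 0 1 0 refl refl
  (upper-half-marked-edge H sizes (marks-on-one-side H _ (bipartite⇒Proper H bip) noP))
  (lower-bound H 0 (λ _ → true) (λ _ _ → false) (λ _ _ ()) RH avoid)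
  where
  avoid : (φ : Fin (v H) → Fin 1) → (∀ i → mark H i ≡ true → true ≡ true) →
    (∀ i j → Adj2 H i j → false ≡ true) → ⊥
  -- The template has no 2-edges, whereas R(H) contains 2.
  avoid φ _ edges with size2⇒pair A |A|≡2
  ... | i , j , i≢j , refl with edges i j (i≢j , A∈E)
  ... | ()

theorem4p6 : (H : Hypergraph) → R≡12 H →
    (∀ χ → IsChromatic2 H χ → ¬ Bipartite2 H → PiEquals H ((+ 2) / 1 - inv (χ ∸ 1)))
    × (Bipartite2 H → P̄2k 0 ⊆H H → PiEquals H ((+ 5) / 4))
    × (Bipartite2 H → (∃ λ k' → P̄2k k' ⊆H H) → ¬ (P̄2k 0 ⊆H H) → PiEquals H ((+ 9) / 8))
    × (Bipartite2 H → (∀ k' → ¬ (P̄2k k' ⊆H H)) → PiEquals H 1ℚ)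
theorem4p6 H RH = chromatic , bipartite-marked-edge H RH , bipartite-closed-path H RH , bipartite-no-closed-path H RH
  where
  chromatic : ∀ χ → IsChromatic2 H χ → ¬ Bipartite2 H → PiEquals H ((+ 2) / 1 - inv (χ ∸ 1))
  chromatic (suc (suc (suc r))) isχ _ = nonbipartite H RH r isχ
  chromatic 0 (col , _) ¬bip = contradiction (Colourable2-mono H z≤n col) ¬bip
  chromatic 1 (col , _) ¬bip = contradiction (Colourable2-mono H (s≤s z≤n) col) ¬bip
  chromatic 2 (col , _) ¬bip = contradiction col ¬bip
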